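{- Let $\mathsf{F}(t)=\sum_{n=0}^\infty \mathcal{F}_n\frac{t^n}{n!}$ be the exponential generating function of the Fibonacci-Fubini numbers. For every integer $r\ge 1$, its $r$th derivative is $$\mathsf{F}^{(r)}(t)= \frac{1}{\sqrt{5}} \sum_{i=1}^{r}e^{it}{r \brace i} \left(\alpha^{i+1} e^{\alpha (e^t-1)}-\beta^{i+1} e^{\beta (e^t-1)}\right).$$
   Context: $\alpha=(1+\sqrt5)/2$ and $\beta=(1-\sqrt5)/2$. ${r\brace i}$ denotes the Stirling number of the second kind (the number of partitions of an $r$-element set into exactly $i$ non-empty blocks). The identity is one of formal power series in $t$, with derivative taken with respect to $t$. A permutation $\sigma=\sigma_1\cdots\sigma_k$ of $\{1,\dots,k\}$ is a Fibonacci permutation if $|\sigma_i-i|\le 1$ for every $i$. For a set partition of $[n]=\{1,\dots,n\}$ into non-empty blocks $B_1|B_2|\cdots|B_k$, the blocks are always listed so that $\min B_1<\min B_2<\cdots<\min B_k$. A Fibonacci ordered partition of $[n]$ is an arrangement $B_{\sigma_1}|B_{\sigma_2}|\cdots|B_{\sigma_k}$ where $B_1|\cdots|B_k$ is a partition of $[n]$ (any number $k$ of blocks) and $\sigma$ is a Fibonacci permutation of $\{1,\dots,k\}$. The Fibonacci-Fubini number $\mathcal{F}_n$ is the total number of Fibonacci ordered partitions of $[n]$ (for $n=0$ the empty partition with $k=0$ blocks is counted once, so $\mathcal{F}_0=1$). -}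

module Defs where

open import Algebra.Apartness.Bundles
  using (HeytingField; HeytingCommutativeRing)
open import Algebra.Bundles using (CommutativeRing; Semiring)
open import Data.Bool.Properties using () renaming (_≟_ to _≟ᵇ_)
open import Data.Fin.Base as Fin using (Fin; toℕ)
import Data.Fin.Properties as Fin
open import Data.Fin.Subset
  using (Subset; inside; outside; _∈_; _∩_; Nonempty; Empty)
open import Data.Fin.Subset.Properties
  using (_∈?_; nonempty?; anySubset?; x∈p∩q⁺)
open import Data.List.Base as List
  using (List; []; _∷_; [_]; length; filter; cartesianProductWith; upTo)
open import Data.Nat.ListAction using (sum)
open import Data.Nat.Base as ℕ using (ℕ; zero; suc; NonZero; ∣_-_∣; _!; _∸_)
import Data.Nat.Properties as ℕ
open import Data.Product.Base using (Σ; ∃; ∃-syntax; _×_; _,_; proj₁; proj₂)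
open import Data.Vec.Base as Vec using (Vec; []; _∷_; lookup)
import Data.Vec.Properties as Vec
open import Function.Definitions using (Injective; StrictlySurjective)
open import Level using (Level)
open import Relation.Binary.PropositionalEquality
  as ≡ using (_≡_; _≢_; subst)
open import Relation.Nullary.Decidable
  using (Dec; yes; no; map′; ¬?; _×-dec_; _→-dec_)
open import Relation.Nullary.Negation using (contradiction)
open import Relation.Unary using (Pred; Decidable)

private variable
  a p : Level
  A   : Set a
  n k : ℕ

-- Every vector with entries in xs, each occurring once if xs has no repeats.
words : List A → (k : ℕ) → List (Vec A k)
words xs zero    = [ [] ]
words xs (suc k) = cartesianProductWith _∷_ xs (words xs k)

subsets : (n : ℕ) → List (Subset n)
subsets = words (inside ∷ outside ∷ [])

count : {P : Pred A p} → Decidable P → List A → ℕ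
count P? xs = length (filter P? xs)

anyVec? : {A : Set} → (∀ {P : A → Set} → Decidable P → Dec (∃ P)) →
          ∀ {k} {P : Vec A k → Set} → Decidable P → Dec (∃ P)
anyVec? any? {zero} P? =
  map′ ([] ,_) (λ { ([] , p) → p }) (P? [])
anyVec? any? {suc k} P? =
  map′ (λ (x , xs , p) → x ∷ xs , p) (λ { (x ∷ xs , p) → x , xs , p })
       (any? λ x → anyVec? any? λ xs → P? (x ∷ xs))

-- The set [n] is represented by Fin n, i.e. shifted to {0,…,n-1}.
IsMin : Subset n → Fin n → Set
IsMin B x = x ∈ B × (∀ y → y ∈ B → x Fin.≤ y)

_≺_ : Subset n → Subset n → Set
B ≺ C = ∃[ x ] ∃[ y ] (IsMin B x × IsMin C y × x Fin.< y)

-- A set partition is identified with the list of its blocks in order of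
-- increasing minimum, so that each partition occurs exactly once.
record IsPartition {n k} (B : Vec (Subset n) k) : Set where
  constructor isPartition
  field
    nonempty : ∀ i → Nonempty (lookup B i)
    disjoint : ∀ i j → i ≢ j → Empty (lookup B i ∩ lookup B j)
    cover    : ∀ x → ∃[ i ] x ∈ lookup B i
    sorted   : ∀ i j → i Fin.< j → lookup B i ≺ lookup B j

isMin? : (B : Subset n) → Decidable (IsMin B)
isMin? B x =
  (x ∈? B) ×-dec Fin.all? λ y → (y ∈? B) →-dec (x Fin.≤? y)

_≺?_ : (B C : Subset n) → Dec (B ≺ C)
B ≺? C = Fin.any? λ x → Fin.any? λ y →
  isMin? B x ×-dec isMin? C y ×-dec (x Fin.<? y)

isPartition? : Decidable (IsPartition {n} {k})
isPartition? B = map′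
  (λ (ne , di , co , so) → isPartition ne di co so)
  (λ (isPartition ne di co so) → ne , di , co , so)
  (      (Fin.all? λ i → nonempty? (lookup B i))
   ×-dec (Fin.all? λ i → Fin.all? λ j →
            ¬? (i Fin.≟ j) →-dec ¬? (nonempty? (lookup B i ∩ lookup B j)))
   ×-dec (Fin.all? λ x → Fin.any? λ i → x ∈? lookup B i)
   ×-dec (Fin.all? λ i → Fin.all? λ j →
            (i Fin.<? j) →-dec (lookup B i ≺? lookup B j)))

-- The number of blocks never exceeds n, so the sum defining 𝓕 below
-- loses nothing by stopping at k = n.
blocks≤ : {B : Vec (Subset n) k} → IsPartition B → k ℕ.≤ n
blocks≤ {B = B} P = Fin.injective⇒≤ {f = pick} pick-injective
  where
  open IsPartition P
  pick = λ i → proj₁ (nonempty i)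

  pick-injective : Injective _≡_ _≡_ pick
  pick-injective {i} {j} eq with i Fin.≟ j
  ... | yes i≡j = i≡j
  ... | no  i≢j = contradiction
    (pick i , x∈p∩q⁺ ( proj₂ (nonempty i)
                     , subst (_∈ lookup B j) (≡.sym eq) (proj₂ (nonempty j))))
    (disjoint i j i≢j)

stirling₂ : ℕ → ℕ → ℕ
stirling₂ r i = count isPartition? (words (subsets r) i)

-- A permutation σ₁⋯σₖ is given by its one-line notation.
record IsFibonacciPermutation {k} (σ : Vec (Fin k) k) : Set where
  constructor isFibonacciPermutation
  field
    injective  : Injective _≡_ _≡_ (lookup σ)
    surjective : StrictlySurjective _≡_ (lookup σ)
    near       : ∀ i → ∣ toℕ (lookup σ i) - toℕ i ∣ ℕ.≤ 1

isFibonacciPermutation? : Decidable (IsFibonacciPermutation {k})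
isFibonacciPermutation? σ = map′
  (λ (inj , sur , nr) → isFibonacciPermutation (inj _ _) sur nr)
  (λ (isFibonacciPermutation inj sur nr) → (λ _ _ → inj) , sur , nr)
  (      (Fin.all? λ i → Fin.all? λ j →
            (lookup σ i Fin.≟ lookup σ j) →-dec (i Fin.≟ j))
   ×-dec (Fin.all? λ j → Fin.any? λ i → lookup σ i Fin.≟ j)
   ×-dec (Fin.all? λ i → ∣ toℕ (lookup σ i) - toℕ i ∣ ℕ.≤? 1))

-- C is the arrangement B_σ₁|⋯|B_σₖ itself, so 𝓕 counts arrangements rather
-- than pairs (B , σ).
IsFibonacciOrderedPartition : Vec (Subset n) k → Set
IsFibonacciOrderedPartition {n} {k} C =
  Σ (Vec (Subset n) k) λ B → Σ (Vec (Fin k) k) λ σ →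
    IsPartition B × IsFibonacciPermutation σ × C ≡ Vec.map (lookup B) σ

isFibonacciOrderedPartition? : Decidable (IsFibonacciOrderedPartition {n} {k})
isFibonacciOrderedPartition? C =
  anyVec? anySubset? λ B → anyVec? Fin.any? λ σ →
    isPartition? B ×-dec isFibonacciPermutation? σ ×-dec
    Vec.≡-dec (Vec.≡-dec _≟ᵇ_) C (Vec.map (lookup B) σ)

𝓕 : ℕ → ℕ
𝓕 n = sum (List.map
  (λ k → count isFibonacciOrderedPartition? (words (subsets n) k))
  (upTo (suc n)))

module Field {c ℓ₁ ℓ₂} (K : HeytingField c ℓ₁ ℓ₂) where
  open HeytingField K public
  open HeytingCommutativeRing heytingCommutativeRing public
    using (commutativeRing)
  open CommutativeRing commutativeRing public
    using (+-monoid; semiring)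
  open import Algebra.Definitions.RawSemiring (Semiring.rawSemiring semiring)
    public
    using (_^_) renaming (_×_ to _·_)

  fromℕ : ℕ → Carrier
  fromℕ n = n · 1#

  -- x # 0# provides an inverse of x - 0#.
  recip : ∀ {x} → x # 0# → Carrier
  recip x#0 = proj₁ (#⇒invertible x#0)

-- The identity only involves elements of ℚ(√5).  It is stated over any field
-- of characteristic zero with a chosen square root of 5, the real numbers
-- being one such.
CharacteristicZero : ∀ {c ℓ₁ ℓ₂} → HeytingField c ℓ₁ ℓ₂ → Set ℓ₂
CharacteristicZero K = ∀ n → .{{NonZero n}} → fromℕ n # 0#
  where open Field K

module PowerSeries {c ℓ₁ ℓ₂} (K : HeytingField c ℓ₁ ℓ₂)
                   (char0 : CharacteristicZero K) where
  open Field K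
  open import Algebra.Properties.Monoid.Sum +-monoid
    using (sum-syntax; sum⁺-syntax)

  -- f n is the coefficient of tⁿ in f.
  Series : Set c
  Series = ℕ → Carrier

  infix  4 _≋_
  infixl 6 _⊖_
  infixr 7 _•_
  infixl 7 _⊛_
  infixr 8 _^ˢ_

  _≋_ : Series → Series → Set ℓ₁
  f ≋ g = ∀ n → f n ≈ g n

  𝟙 : Series
  𝟙 zero    = 1#
  𝟙 (suc _) = 0#

  t : Series
  t zero    = 0#
  t (suc n) = 𝟙 n

  _⊖_ : Series → Series → Series
  (f ⊖ g) n = f n - g n

  _•_ : Carrier → Series → Series
  (x • f) n = x * f n

  _⊛_ : Series → Series → Series
  (f ⊛ g) n = ∑[ i ≤ n ] (f (toℕ i) * g (n ∸ toℕ i))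

  _^ˢ_ : Series → ℕ → Series
  f ^ˢ zero  = 𝟙
  f ^ˢ suc m = f ⊛ f ^ˢ m

  -- Indices run over 1 ≤ i ≤ r.
  ∑₁ : ℕ → (ℕ → Series) → Series
  ∑₁ r f n = ∑[ i < r ] f (suc (toℕ i)) n

  recip! : ℕ → Carrier
  recip! n = recip (char0 (n !) {{n ℕ.!≢0}})

  -- ∑ₘ fᵐ/m!, meaningful only for f with zero constant term: fᵐ then starts
  -- in degree m, so only m ≤ n contribute to the coefficient of tⁿ.
  exp : Series → Series
  exp f n = ∑[ m ≤ n ] (recip! (toℕ m) * (f ^ˢ toℕ m) n)

  ∂ : Series → Series
  ∂ f n = fromℕ (suc n) * f (suc n)

  ∂^ : ℕ → Series → Series
  ∂^ zero    f = f
  ∂^ (suc r) f = ∂ (∂^ r f)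

  egf : (ℕ → ℕ) → Series
  egf u n = fromℕ (u n) * recip! n

module GoldenRatio {c ℓ₁ ℓ₂} (K : HeytingField c ℓ₁ ℓ₂)
                   (char0 : CharacteristicZero K)
                   (√5 : Field.Carrier K)
                   (√5²≈5 : Field._≈_ K (Field._*_ K √5 √5) (Field.fromℕ K 5))
                   where
  open Field K
  open import Algebra.Apartness.Properties.HeytingCommutativeRing
    heytingCommutativeRing using (invertibleˡ⇒#; #-congʳ; x-0≈x)

  x*x#0⇒x#0 : ∀ {x} → x * x # 0# → x # 0#
  x*x#0⇒x#0 {x} x²#0 with #⇒invertible x²#0
  ... | y , y[x²-0]≈1 , _ = invertibleˡ⇒# (y * x ,
    trans (*-congˡ (x-0≈x x))
      (trans (*-assoc y x x)
        (trans (*-congˡ (sym (x-0≈x (x * x)))) y[x²-0]≈1)))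

  √5#0 : √5 # 0#
  √5#0 = x*x#0⇒x#0 (#-congʳ (sym √5²≈5) (char0 5))

  1/√5 α β : Carrier
  1/√5 = recip √5#0
  α    = (1# + √5) * recip (char0 2)
  β    = (1# - √5) * recip (char0 2)

{-# OPTIONS --safe #-}

-- Deal out the elements of [n] in increasing order, keeping track of the number
-- m of blocks opened so far: the next element joins one of these m blocks or
-- opens the next one, so the numbers R(n,m) of continuations ending with k
-- blocks satisfy R(n+1,m) = m R(n,m) + R(n,m+1), and R(n,0) = S(n,k).  Over
-- power series, Hₘ = xᵐ eᵐᵗ exp(x(eᵗ−1)) satisfies Hₘ′ = m Hₘ + Hₘ₊₁, the same
-- recurrence, whence H₀⁽ⁿ⁾ = ∑ₖ S(n,k) Hₖ.  At t = 0 this gives the coefficients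
-- of exp(x(eᵗ−1)); as a sorted partition and a Fibonacci permutation can be
-- recovered from the arrangement, 𝓕ₙ = ∑ₖ S(n,k) Fₖ₊₁, and Binet's formula turns F
-- into a combination of the series H₀ for x = α and x = β.
module Submission where

open import Defs
open import Algebra.Apartness.Bundles using (HeytingField)
open import Algebra.Bundles using (CommutativeRing)
open import Data.Fin.Base as Fin using (Fin; zero; suc; toℕ; fromℕ<; inject₁)
import Data.Fin.Properties as Fin
open import Data.Fin.Induction using (<-weakInduction)
open import Data.Fin.Subset using (Subset; inside; outside; ⁅_⁆; _∈_; _∉_; Nonempty)
open import Data.Fin.Subset.Properties
  using (x∈⁅x⁆; x∈⁅y⁆⇒x≡y; x∈p∩q⁺; x∈p∩q⁻)
open import Data.Bool.Base using (true; false)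
open import Data.List.Base as List
  using (List; []; _∷_; [_]; _++_; length; filter; cartesianProduct;
         cartesianProductWith; allFin; applyUpTo; upTo)
import Data.List.Properties as List
open import Data.List.Membership.Propositional
  using () renaming (_∈_ to _∈ₗ_; _∉_ to _∉ₗ_)
open import Data.List.Membership.Propositional.Properties
  using (∈-cartesianProductWith⁺; ∈-cartesianProductWith⁻; ∈-cartesianProduct⁺;
         ∈-cartesianProduct⁻; ∈-filter⁺; ∈-filter⁻; ∈-++⁺ˡ; ∈-++⁺ʳ; ∈-++⁻;
         ∈-allFin; ∈-map⁺; ∈-map⁻; ∈-upTo⁺; ∈-upTo⁻)
open import Data.List.Membership.Propositional.Properties.WithK using (unique∧set⇒bag)
open import Data.List.Relation.Binary.BagAndSetEquality using (∼bag⇒↭)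
open import Data.List.Relation.Binary.Permutation.Propositional.Properties
  using (↭-length)
open import Data.List.Relation.Unary.All as All using ()
open import Data.List.Relation.Unary.AllPairs using ([]; _∷_)
open import Data.List.Relation.Unary.Any using (here; there)
open import Data.List.Relation.Unary.Unique.Propositional using (Unique)
import Data.List.Relation.Unary.Unique.Propositional.Properties as Unique
open import Data.Nat.Base as ℕ
  using (ℕ; zero; suc; _≤_; _<_; z≤n; s≤s; _!; _∸_; ∣_-_∣)
import Data.Nat.Properties as ℕ
open import Data.Nat.ListAction using (sum)
open import Data.Product.Base using (∃; ∃₂; ∃-syntax; _×_; _,_; proj₁; proj₂)
open import Data.Sum.Base using (inj₁; inj₂)
open import Data.Vec.Base as Vec
  using (Vec; []; _∷_; lookup; tabulate; zipWith; replicate)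
import Data.Vec.Properties as Vec
open import Function.Base using (_∘_; _∘′_; id; case_of_)
open import Function.Bundles using (mk⇔)
open import Function.Definitions using (Injective)
open import Level using (Level)
open import Relation.Binary.Definitions using (tri<; tri≈; tri>)
import Relation.Binary.PropositionalEquality as ≡
open ≡ using (_≡_; _≢_)
open import Relation.Nullary.Decidable using (yes; no)
open import Relation.Nullary.Negation using (¬_; contradiction)
open import Relation.Unary using (Pred; Decidable)

-- Both `stirling₂` and `𝓕` count by testing every vector of subsets, which gives no recursion to
-- work with. Each count is therefore replaced by the length of a recursively built duplicate-free
-- list with the same members. Removing the smallest element is the natural recursion, but it leads
-- out of the class of partitions: the block that held the element may become empty, and then it has
-- no minimum to be sorted by. The number m of opened blocks is there to repair this; only m = 0
-- speaks about partitions. On the series side no closed formula for Stirling numbers is needed. The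
-- expansion of the derivatives of H₀ serves twice: its constant terms identify the generating
-- function, and for n = r it differentiates that function, which is where the factor eⁱᵗ comes
-- from. The exponent i + 1 instead of i comes from the Fibonacci index k + 1: Binet's formula
-- contributes one more factor α or β.

module OrderedPartitions where
  open ≡ using (refl; sym; trans; cong; cong₂; subst; subst₂; module ≡-Reasoning)

  private variable
    a b c p : Level
    A : Set a
    B : Set b
    n k m m′ : ℕ

  -- Counting with duplicate-free lists

  -- For duplicate-free lists equality as sets is already equality as bags, hence a permutation, so
  -- no bijection has to be written down.
  unique-length : {xs ys : List A} → Unique xs → Unique ys →
                  (∀ {x} → x ∈ₗ xs → x ∈ₗ ys) → (∀ {x} → x ∈ₗ ys → x ∈ₗ xs) →
                  length xs ≡ length ys
  unique-length xs! ys! to from =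
    ↭-length (∼bag⇒↭ (unique∧set⇒bag xs! ys! (mk⇔ to from)))

  -- The bridge from the brute-force counts of the definitions to recursive enumerations: filtering
  -- a complete duplicate-free list leaves each solution of `P` exactly once.
  count≡length : {P : Pred A p} (P? : Decidable P) {xs ys : List A} →
                 Unique xs → (∀ x → x ∈ₗ xs) → Unique ys →
                 (∀ {x} → P x → x ∈ₗ ys) → (∀ {x} → x ∈ₗ ys → P x) →
                 count P? xs ≡ length ys
  count≡length P? {xs} xs! ∈xs ys! to from =
    unique-length (Unique.filter⁺ P? xs!) ys!
      (λ x∈ → to (proj₂ (∈-filter⁻ P? {xs = xs} x∈))) (λ x∈ys → ∈-filter⁺ P? (∈xs _) (from x∈ys))

  length-cartesianProductWith : {C : Set c} (f : A → B → C) (xs : List A) (ys : List B) →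
                                length (cartesianProductWith f xs ys) ≡ length xs ℕ.* length ys
  length-cartesianProductWith f []       ys = refl
  length-cartesianProductWith f (x ∷ xs) ys = begin
    length (List.map (f x) ys ++ cartesianProductWith f xs ys)
      ≡⟨ List.length-++ (List.map (f x) ys) ⟩
    length (List.map (f x) ys) ℕ.+ length (cartesianProductWith f xs ys)
      ≡⟨ cong₂ ℕ._+_ (List.length-map (f x) ys) (length-cartesianProductWith f xs ys) ⟩
    length ys ℕ.+ length xs ℕ.* length ys ∎
    where open ≡-Reasoning

  -- Injectivity is asked on members only, because `arrange` is shown injective only on pairs of a
  -- sorted partition and a Fibonacci permutation.
  map-unique : {f : A → B} {xs : List A} →
               (∀ {x y} → x ∈ₗ xs → y ∈ₗ xs → f x ≡ f y → x ≡ y) →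
               Unique xs → Unique (List.map f xs)
  map-unique {xs = []} inj [] = []
  map-unique {f = f} {xs = x ∷ xs} inj (x∉xs ∷ xs!) =
    All.tabulate fresh ∷ map-unique (λ p q → inj (there p) (there q)) xs!
    where
    fresh : ∀ {z} → z ∈ₗ List.map f xs → f x ≢ z
    fresh z∈ fx≡z with y , y∈xs , z≡fy ← ∈-map⁻ f z∈ =
      All.lookup x∉xs y∈xs (inj (here refl) (there y∈xs) (trans fx≡z z≡fy))

  words-unique : {xs : List A} → Unique xs → ∀ k → Unique (words xs k)
  words-unique xs! zero    = All.[] ∷ []
  words-unique xs! (suc k) =
    Unique.cartesianProductWith⁺ _∷_ Vec.∷-injective xs! (words-unique xs! k)

  words-complete : {xs : List A} → (∀ x → x ∈ₗ xs) → (v : Vec A k) → v ∈ₗ words xs k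
  words-complete ∈xs []      = here refl
  words-complete ∈xs (x ∷ v) =
    ∈-cartesianProductWith⁺ _∷_ (∈xs x) (words-complete ∈xs v)

  subsets-unique : ∀ n → Unique (subsets n)
  subsets-unique = words-unique (((λ ()) All.∷ All.[]) ∷ (All.[] ∷ []))

  subsets-complete : (s : Subset n) → s ∈ₗ subsets n
  subsets-complete = words-complete λ where
    true  → here refl
    false → there (here refl)

  lookup-ext : {u v : Vec A n} → (∀ i → lookup u i ≡ lookup v i) → u ≡ v
  lookup-ext {u = u} {v} eq = begin
    u                     ≡⟨ Vec.tabulate∘lookup u ⟨
    tabulate (lookup u)   ≡⟨ Vec.tabulate-cong eq ⟩
    tabulate (lookup v)   ≡⟨ Vec.tabulate∘lookup v ⟩
    v                     ∎
    where open ≡-Reasoning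

  -- Order of blocks and insertion of a new smallest element

  minimum : (s : Subset n) → Nonempty s → ∃ (IsMin s)
  minimum (inside  ∷ s) _ = zero , Vec.here , λ _ _ → z≤n
  minimum (outside ∷ s) (suc x , Vec.there x∈s) with minimum s (x , x∈s)
  ... | y , y∈s , y≤ = suc y , Vec.there y∈s , λ { (suc z) (Vec.there z∈s) → s≤s (y≤ z z∈s) }

  -- A form of `≺` without minima: one witness in s lies below all of t. It is easy to transport
  -- when an element is added or removed, and agrees with `≺` as soon as t is nonempty.
  _◁_ : Subset n → Subset n → Set
  s ◁ t = ∃[ x ] x ∈ s × (∀ y → y ∈ t → x Fin.< y)

  ≺⇒◁ : {s t : Subset n} → s ≺ t → s ◁ t
  ≺⇒◁ (x , y , (x∈s , _) , (_ , y≤) , x<y) =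
    x , x∈s , λ z z∈t → ℕ.<-≤-trans x<y (y≤ z z∈t)

  ◁⇒≺ : {s t : Subset n} → Nonempty t → s ◁ t → s ≺ t
  ◁⇒≺ {s = s} {t} t≢∅ (x , x∈s , x<)
    with x₀ , min@(_ , x₀≤) ← minimum s (x , x∈s)
       | y₀ , min′@(y₀∈t , _) ← minimum t t≢∅
    = x₀ , y₀ , min , min′ , ℕ.≤-<-trans (x₀≤ x x∈s) (x< y₀ y₀∈t)

  -- The situation met when the elements of a partition are distributed in
  -- increasing order: the first m blocks have already received an element, so
  -- they may be empty on the elements still to come and are not compared.
  record IsContinuation (m : ℕ) (B : Vec (Subset n) k) : Set where
    field
      m≤k      : m ≤ k
      nonempty : ∀ i → m ≤ toℕ i → Nonempty (lookup B i)
      disjoint : ∀ {x i j} → x ∈ lookup B i → x ∈ lookup B j → i ≡ j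
      cover    : ∀ x → ∃[ i ] x ∈ lookup B i
      sorted   : ∀ {i j} → m ≤ toℕ i → i Fin.< j → lookup B i ◁ lookup B j

  continuation⇒partition : {B : Vec (Subset n) k} → IsContinuation 0 B → IsPartition B
  continuation⇒partition C = isPartition
    (λ i → nonempty i z≤n)
    (λ i j i≢j (x , x∈) → i≢j (let x∈i , x∈j = x∈p∩q⁻ _ _ x∈ in disjoint x∈i x∈j))
    cover
    (λ i j i<j → ◁⇒≺ (nonempty j z≤n) (sorted z≤n i<j))
    where open IsContinuation C

  partition⇒continuation : {B : Vec (Subset n) k} → IsPartition B → IsContinuation 0 B
  partition⇒continuation P = record
    { m≤k      = z≤n
    ; nonempty = λ i _ → nonempty i
    ; disjoint = λ {x} {i} {j} x∈i x∈j → case i Fin.≟ j of λ where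
        (yes i≡j) → i≡j
        (no  i≢j) → contradiction (x , x∈p∩q⁺ (x∈i , x∈j)) (disjoint i j i≢j)
    ; cover    = cover
    ; sorted   = λ {i} {j} _ i<j → ≺⇒◁ (sorted i j i<j)
    }
    where
    open IsPartition P

  -- `⁅ i ⁆` is here a set of block indices: its entry at j is the flag saying whether the new
  -- smallest element lies in block j.
  add : Fin k → Vec (Subset n) k → Vec (Subset (suc n)) k
  add i B = zipWith _∷_ ⁅ i ⁆ B

  module _ (i : Fin k) (B : Vec (Subset n) k) where

    private
      lookup-add : ∀ j → lookup (add i B) j ≡ lookup ⁅ i ⁆ j ∷ lookup B j
      lookup-add j = Vec.lookup-zipWith _∷_ j ⁅ i ⁆ B

    zero∈add⁺ : zero ∈ lookup (add i B) i
    zero∈add⁺ rewrite lookup-add i | Vec.[]=⇒lookup (x∈⁅x⁆ i) = Vec.here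

    zero∈add⁻ : ∀ {j} → zero ∈ lookup (add i B) j → j ≡ i
    zero∈add⁻ {j} 0∈ = x∈⁅y⁆⇒x≡y i (Vec.lookup⇒[]= j ⁅ i ⁆
      (Vec.[]=⇒lookup (subst (zero ∈_) (lookup-add j) 0∈)))

    suc∈add⁺ : ∀ {j x} → x ∈ lookup B j → suc x ∈ lookup (add i B) j
    suc∈add⁺ {j} x∈ = subst (suc _ ∈_) (sym (lookup-add j)) (Vec.there x∈)

    suc∈add⁻ : ∀ {j x} → suc x ∈ lookup (add i B) j → x ∈ lookup B j
    suc∈add⁻ {j} x∈ with Vec.there x∈′ ← subst (suc _ ∈_) (lookup-add j) x∈ = x∈′

  add-injective : {i j : Fin k} {B C : Vec (Subset n) k} →
                  add i B ≡ add j C → i ≡ j × B ≡ C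
  add-injective {i = i} {j} {B} {C} eq =
    zero∈add⁻ j C (subst (λ D → zero ∈ lookup D i) eq (zero∈add⁺ i B)) ,
    lookup-ext λ x → Vec.∷-injectiveʳ (begin
      lookup ⁅ i ⁆ x ∷ lookup B x ≡⟨ Vec.lookup-zipWith _∷_ x ⁅ i ⁆ B ⟨
      lookup (add i B) x          ≡⟨ cong (λ D → lookup D x) eq ⟩
      lookup (add j C) x          ≡⟨ Vec.lookup-zipWith _∷_ x ⁅ j ⁆ C ⟩
      lookup ⁅ j ⁆ x ∷ lookup C x ∎)
    where open ≡-Reasoning

  module _ {i : Fin k} {B : Vec (Subset n) k} where

    -- The blocks with index at least m do not receive the new element, so their conditions merely
    -- shift by `suc`.
    add-old : toℕ i < m → IsContinuation m B → IsContinuation m (add i B)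
    add-old {m} i<m C = record
      { m≤k      = m≤k
      ; nonempty = λ j m≤j → let x , x∈ = nonempty j m≤j in suc x , suc∈add⁺ i B x∈
      ; disjoint = disj
      ; cover    = cov
      ; sorted   = sort
      }
      where
      open IsContinuation C
      disj : ∀ {x j j′} → x ∈ lookup (add i B) j → x ∈ lookup (add i B) j′ → j ≡ j′
      disj {zero}  p q = trans (zero∈add⁻ i B p) (sym (zero∈add⁻ i B q))
      disj {suc x} p q = disjoint (suc∈add⁻ i B p) (suc∈add⁻ i B q)
      cov : ∀ x → ∃[ j ] x ∈ lookup (add i B) j
      cov zero    = i , zero∈add⁺ i B
      cov (suc x) = let j , x∈ = cover x in j , suc∈add⁺ i B x∈
      sort : ∀ {j j′} → m ≤ toℕ j → j Fin.< j′ → lookup (add i B) j ◁ lookup (add i B) j′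
      sort m≤j j<j′ with x , x∈ , x< ← sorted m≤j j<j′ =
        suc x , suc∈add⁺ i B x∈ , λ where
          zero    0∈ → contradiction
            (ℕ.<-≤-trans (subst (λ l → toℕ l < m) (sym (zero∈add⁻ i B 0∈)) i<m) m≤j)
            (ℕ.<-asym j<j′)
          (suc y) y∈ → s≤s (x< y (suc∈add⁻ i B y∈))

    -- Block i receives the smallest element of all, so `zero` witnesses that it precedes every
    -- later block. The blocks beyond i are covered by `add-old` with bound i + 1.
    add-new : IsContinuation (suc (toℕ i)) B → IsContinuation (toℕ i) (add i B)
    add-new C = record
      { m≤k      = ℕ.<⇒≤ m≤k
      ; nonempty = ne
      ; disjoint = IsContinuation.disjoint C′
      ; cover    = IsContinuation.cover C′
      ; sorted   = sort
      }
      where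
      open IsContinuation C
      C′ = add-old ℕ.≤-refl C
      ne : ∀ j → toℕ i ≤ toℕ j → Nonempty (lookup (add i B) j)
      ne j i≤j with i Fin.≟ j
      ... | yes refl = zero , zero∈add⁺ i B
      ... | no  i≢j  = IsContinuation.nonempty C′ j (ℕ.≤∧≢⇒< i≤j (i≢j ∘ Fin.toℕ-injective))
      sort : ∀ {j j′} → toℕ i ≤ toℕ j → j Fin.< j′ →
             lookup (add i B) j ◁ lookup (add i B) j′
      sort {j} i≤j j<j′ with i Fin.≟ j
      ... | no  i≢j  = IsContinuation.sorted C′
                         (ℕ.≤∧≢⇒< i≤j (i≢j ∘ Fin.toℕ-injective)) j<j′
      ... | yes refl = zero , zero∈add⁺ i B , λ where
        zero    0∈ → contradiction (cong toℕ (sym (zero∈add⁻ i B 0∈))) (ℕ.<⇒≢ j<j′)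
        (suc _) _  → s≤s z≤n

    -- Inverts both ways of adding: m′ = m if block i was opened before, m′ = m + 1 if i = m opens
    -- now. In either case i < m′ keeps `zero` out of the blocks still compared, so every witness
    -- there is a successor.
    add⁻ : m ≤ m′ → m′ ≤ k → toℕ i < m′ → IsContinuation m (add i B) → IsContinuation m′ B
    add⁻ {m} {m′} m≤m′ m′≤k i<m′ C = record
      { m≤k      = m′≤k
      ; nonempty = ne
      ; disjoint = λ p q → disjoint (suc∈add⁺ i B p) (suc∈add⁺ i B q)
      ; cover    = λ x → let j , x∈ = cover (suc x) in j , suc∈add⁻ i B x∈
      ; sorted   = sort
      }
      where
      open IsContinuation C
      zero∉ : ∀ {j} → m′ ≤ toℕ j → zero ∉ lookup (add i B) j
      zero∉ m′≤j 0∈ rewrite zero∈add⁻ i B 0∈ = ℕ.<⇒≱ i<m′ m′≤j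
      ne : ∀ j → m′ ≤ toℕ j → Nonempty (lookup B j)
      ne j m′≤j with nonempty j (ℕ.≤-trans m≤m′ m′≤j)
      ... | zero  , 0∈ = contradiction 0∈ (zero∉ m′≤j)
      ... | suc x , x∈ = x , suc∈add⁻ i B x∈
      sort : ∀ {j j′} → m′ ≤ toℕ j → j Fin.< j′ → lookup B j ◁ lookup B j′
      sort m′≤j j<j′ with sorted (ℕ.≤-trans m≤m′ m′≤j) j<j′
      ... | zero  , 0∈ , _  = contradiction 0∈ (zero∉ m′≤j)
      ... | suc x , x∈ , x< =
        x , suc∈add⁻ i B x∈ , λ y y∈ → ℕ.≤-pred (x< (suc y) (suc∈add⁺ i B y∈))

    -- A block beyond the next one to be opened cannot contain the smallest
    -- remaining element.
    add-≤ : IsContinuation m (add i B) → toℕ i ≤ m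
    add-≤ {m} C = ℕ.≮⇒≥ λ m<i →
      let m<k = ℕ.<-trans m<i (Fin.toℕ<n i)
          j≡m = Fin.toℕ-fromℕ< m<k
          x , _ , x< = IsContinuation.sorted C {i = fromℕ< m<k} {j = i}
                         (ℕ.≤-reflexive (sym j≡m)) (subst (_< toℕ i) (sym j≡m) m<i)
      in contradiction (x< zero (zero∈add⁺ i B)) λ ()

  -- Cover and disjointness at `zero` say that exactly one block contains the smallest element, so
  -- the flags of that element form a singleton.
  add-surjective : {B : Vec (Subset (suc n)) k} → IsContinuation m B →
                   ∃₂ λ i C → B ≡ add i C
  add-surjective {B = B} C = i , Vec.map Vec.tail B , lookup-ext λ j → begin
    lookup B j                                      ≡⟨ split j (lookup B j) refl ⟩
    lookup ⁅ i ⁆ j ∷ Vec.tail (lookup B j)          ≡⟨ cong (_ ∷_) (Vec.lookup-map j Vec.tail B) ⟨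
    lookup ⁅ i ⁆ j ∷ lookup (Vec.map Vec.tail B) j  ≡⟨ Vec.lookup-zipWith _∷_ j ⁅ i ⁆ _ ⟨
    lookup (add i (Vec.map Vec.tail B)) j           ∎
    where
    open IsContinuation C
    open ≡-Reasoning
    i = proj₁ (cover zero)
    split : ∀ j s → lookup B j ≡ s → s ≡ lookup ⁅ i ⁆ j ∷ Vec.tail s
    split j (inside ∷ s) eq
      with refl ← disjoint (proj₂ (cover zero)) (subst (zero ∈_) (sym eq) Vec.here)
      = cong (_∷ s) (sym (Vec.[]=⇒lookup (x∈⁅x⁆ i)))
    split j (outside ∷ s) eq with lookup ⁅ i ⁆ j in eq′
    ... | outside = refl
    ... | inside with refl ← x∈⁅y⁆⇒x≡y i (Vec.lookup⇒[]= j ⁅ i ⁆ eq′)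
        with () ← subst (zero ∈_) eq (proj₂ (cover zero))

  -- Enumeration of continuations and its recurrence

  opened next : ∀ k → ℕ → List (Fin k)
  opened k m = filter (λ i → toℕ i ℕ.<? m) (allFin k)
  next   k m = filter (λ i → toℕ i ℕ.≟ m) (allFin k)

  ∈opened⁻ : {i : Fin k} → i ∈ₗ opened k m → toℕ i < m
  ∈opened⁻ {k} i∈ = proj₂ (∈-filter⁻ _ {xs = allFin k} i∈)

  ∈next⁻ : {i : Fin k} → i ∈ₗ next k m → toℕ i ≡ m
  ∈next⁻ {k} i∈ = proj₂ (∈-filter⁻ _ {xs = allFin k} i∈)

  -- When no element is left all blocks are empty, which is admissible only if every one of the k
  -- blocks has been opened, that is, m = k.
  continuations : (k n m : ℕ) → List (Vec (Subset n) k)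
  continuations k zero    m = filter (λ _ → m ℕ.≟ k) [ replicate k [] ]
  continuations k (suc n) m =
    cartesianProductWith add (opened k m) (continuations k n m) ++
    cartesianProductWith add (next k m) (continuations k n (suc m))

  ∈continuations⁺ : ∀ n {m : ℕ} {B : Vec (Subset n) k} →
                    IsContinuation m B → B ∈ₗ continuations k n m
  ∈continuations⁺ {k} zero {m} {B} C =
    ∈-filter⁺ (λ _ → m ℕ.≟ k) (here (lookup-ext λ i → empty (lookup B i) _))
      -- If m < k, the unopened block m would need an element, and none remains.
      (ℕ.≤-antisym m≤k (ℕ.≮⇒≥ λ m<k →
        contradiction (nonempty (fromℕ< m<k) (ℕ.≤-reflexive (sym (Fin.toℕ-fromℕ< m<k)))) λ ()))
    where
    open IsContinuation C
    empty : ∀ (s t : Subset 0) → s ≡ t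
    empty [] [] = refl
  ∈continuations⁺ {k} (suc n) {m} C
    with i , B′ , refl ← add-surjective C
    with ℕ.m≤n⇒m<n∨m≡n (add-≤ C)
  ... | inj₁ i<m  = ∈-++⁺ˡ (∈-cartesianProductWith⁺ add
    (∈-filter⁺ (λ i → toℕ i ℕ.<? m) (∈-allFin i) i<m)
    (∈continuations⁺ n (add⁻ ℕ.≤-refl (IsContinuation.m≤k C) i<m C)))
  ... | inj₂ refl = ∈-++⁺ʳ _ (∈-cartesianProductWith⁺ add
    (∈-filter⁺ (λ j → toℕ j ℕ.≟ toℕ i) (∈-allFin i) refl)
    (∈continuations⁺ n (add⁻ (ℕ.n≤1+n _) (Fin.toℕ<n i) ℕ.≤-refl C)))

  ∈continuations⁻ : ∀ n {m : ℕ} {B : Vec (Subset n) k} →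
                    B ∈ₗ continuations k n m → IsContinuation m B
  ∈continuations⁻ {k} zero {m} B∈
    with here refl , refl ← ∈-filter⁻ (λ _ → m ℕ.≟ k) {xs = [ replicate k [] ]} B∈
    = record
    { m≤k      = ℕ.≤-refl
    ; nonempty = λ i k≤i → contradiction k≤i (ℕ.<⇒≱ (Fin.toℕ<n i))
    ; disjoint = λ { {()} }
    ; cover    = λ ()
    ; sorted   = λ {i} k≤i _ → contradiction k≤i (ℕ.<⇒≱ (Fin.toℕ<n i))
    }
  ∈continuations⁻ {k} (suc n) {m} B∈ with ∈-++⁻ _ B∈
  ... | inj₁ B∈ˡ
      with i , C , i∈ , C∈ , refl ← ∈-cartesianProductWith⁻ add (opened k m) (continuations k n m) B∈ˡ
      = add-old (∈opened⁻ i∈)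
                (∈continuations⁻ n C∈)
  ... | inj₂ B∈ʳ
      with i , C , i∈ , C∈ , refl ← ∈-cartesianProductWith⁻ add (next k m) (continuations k n (suc m)) B∈ʳ
      with refl ← ∈next⁻ i∈
      = add-new (∈continuations⁻ n C∈)

  -- The two halves of the list are disjoint because the block that takes the smallest element can
  -- be read off: its index is below m in one and equal to m in the other.
  continuations-unique : ∀ k n m → Unique (continuations k n m)
  continuations-unique k zero    m = Unique.filter⁺ (λ _ → m ℕ.≟ k) (All.[] ∷ [])
  continuations-unique k (suc n) m = Unique.++⁺
    (Unique.cartesianProductWith⁺ add add-injective
      (Unique.filter⁺ (λ i → toℕ i ℕ.<? m) (Unique.allFin⁺ k)) (continuations-unique k n m))
    (Unique.cartesianProductWith⁺ add add-injective
      (Unique.filter⁺ (λ i → toℕ i ℕ.≟ m) (Unique.allFin⁺ k)) (continuations-unique k n (suc m)))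
    disjoint
    where
    disjoint : ∀ {B} → ¬ (B ∈ₗ cartesianProductWith add (opened k m) (continuations k n m) ×
                          B ∈ₗ cartesianProductWith add (next k m) (continuations k n (suc m)))
    disjoint (p , q)
      with i , C , i∈ , _ , refl ← ∈-cartesianProductWith⁻ add (opened k m) (continuations k n m) p
         | j , D , j∈ , _ , eq ← ∈-cartesianProductWith⁻ add (next k m) (continuations k n (suc m)) q
      with refl ← proj₁ (add-injective {i = i} {j} {C} {D} eq)
      with refl ← ∈next⁻ j∈
      = ℕ.n≮n _ (∈opened⁻ i∈)

  #continuations : ℕ → ℕ → ℕ → ℕ
  #continuations k n m = length (continuations k n m)

  #continuations-diag : ∀ k → #continuations k 0 k ≡ 1
  #continuations-diag k = cong length (List.filter-accept (λ _ → k ℕ.≟ k) refl)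

  #continuations-off-diag : k ≢ m → #continuations k 0 m ≡ 0
  #continuations-off-diag {k} {m} k≢m = cong length (List.filter-reject (λ _ → m ℕ.≟ k) (k≢m ∘ sym))

  #continuations-> : ∀ n → k < m → #continuations k n m ≡ 0
  #continuations-> n k<m = none _ λ B∈ →
    ℕ.<⇒≱ k<m (IsContinuation.m≤k (∈continuations⁻ n B∈))
    where
    none : (xs : List A) → (∀ {x} → x ∉ₗ xs) → length xs ≡ 0
    none []       _  = refl
    none (x ∷ xs) ∉ = contradiction (here refl) ∉

  length-opened : m ≤ k → length (opened k m) ≡ m
  length-opened {m} {k} m≤k = begin
    length (filter <m? (allFin k))                 ≡⟨ List.length-map toℕ (opened k m) ⟨
    length (List.map toℕ (filter <m? (allFin k)))  ≡⟨ unique-length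
      (Unique.map⁺ Fin.toℕ-injective (Unique.filter⁺ <m? (Unique.allFin⁺ k)))
      (Unique.upTo⁺ m) to from ⟩
    length (upTo m)                                ≡⟨ List.length-upTo m ⟩
    m                                              ∎
    where
    open ≡-Reasoning
    <m? : Decidable (λ (i : Fin k) → toℕ i < m)
    <m? i = toℕ i ℕ.<? m
    to : ∀ {x} → x ∈ₗ List.map toℕ (filter <m? (allFin k)) → x ∈ₗ upTo m
    to x∈ with i , i∈ , refl ← ∈-map⁻ toℕ x∈ = ∈-upTo⁺ (∈opened⁻ i∈)
    from : ∀ {x} → x ∈ₗ upTo m → x ∈ₗ List.map toℕ (filter <m? (allFin k))
    from x∈ =
      let x<m = ∈-upTo⁻ x∈
          eq  = Fin.toℕ-fromℕ< (ℕ.<-≤-trans x<m m≤k)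
      in subst (_∈ₗ _) eq (∈-map⁺ toℕ (∈-filter⁺ <m? (∈-allFin _) (subst (_< m) (sym eq) x<m)))

  length-next : m < k → length (next k m) ≡ 1
  length-next {m} {k} m<k = unique-length
    (Unique.filter⁺ ≡m? (Unique.allFin⁺ k)) (All.[] ∷ []) to from
    where
    ≡m? : Decidable (λ (i : Fin k) → toℕ i ≡ m)
    ≡m? i = toℕ i ℕ.≟ m
    to : ∀ {i} → i ∈ₗ filter ≡m? (allFin k) → i ∈ₗ [ fromℕ< m<k ]
    to i∈ = here (Fin.toℕ-injective
      (trans (∈next⁻ i∈) (sym (Fin.toℕ-fromℕ< m<k))))
    from : ∀ {i} → i ∈ₗ [ fromℕ< m<k ] → i ∈ₗ filter ≡m? (allFin k)
    from (here refl) = ∈-filter⁺ ≡m? (∈-allFin _) (Fin.toℕ-fromℕ< m<k)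

  -- Out of range the lists have the wrong length: `next k m` is empty for m ≥ k, and `opened k m`
  -- has only k entries for m > k. The counts that they multiply are zero in these cases, so the
  -- recurrence holds for all m.
  #continuations-suc : ∀ k n m → #continuations k (suc n) m ≡
                       m ℕ.* #continuations k n m ℕ.+ #continuations k n (suc m)
  #continuations-suc k n m = begin
    #continuations k (suc n) m
      ≡⟨ List.length-++ (cartesianProductWith add old (continuations k n m)) ⟩
    length (cartesianProductWith add old (continuations k n m)) ℕ.+
    length (cartesianProductWith add new (continuations k n (suc m)))
      ≡⟨ cong₂ ℕ._+_ (length-cartesianProductWith add old _) (length-cartesianProductWith add new _) ⟩
    length old ℕ.* #continuations k n m ℕ.+ length new ℕ.* #continuations k n (suc m)
      ≡⟨ cong₂ ℕ._+_ old≡ new≡ ⟩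
    m ℕ.* #continuations k n m ℕ.+ #continuations k n (suc m) ∎
    where
    open ≡-Reasoning
    old = opened k m
    new = next k m
    zero* : ∀ x y {z} → z ≡ 0 → x ℕ.* z ≡ y ℕ.* z
    zero* x y refl = trans (ℕ.*-zeroʳ x) (sym (ℕ.*-zeroʳ y))
    old≡ : length old ℕ.* #continuations k n m ≡ m ℕ.* #continuations k n m
    old≡ with m ℕ.≤? k
    ... | yes m≤k = cong (ℕ._* #continuations k n m) (length-opened m≤k)
    ... | no  m≰k = zero* (length old) m (#continuations-> n (ℕ.≰⇒> m≰k))
    new≡ : length new ℕ.* #continuations k n (suc m) ≡ #continuations k n (suc m)
    new≡ with m ℕ.<? k
    ... | yes m<k = trans (cong (ℕ._* #continuations k n (suc m)) (length-next m<k)) (ℕ.*-identityˡ _)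
    ... | no  m≮k = trans (zero* (length new) 1 (#continuations-> n (s≤s (ℕ.≮⇒≥ m≮k)))) (ℕ.*-identityˡ _)

  stirling₂≡#continuations : ∀ n k → stirling₂ n k ≡ #continuations k n 0
  stirling₂≡#continuations n k = count≡length isPartition?
    (words-unique (subsets-unique n) k) (words-complete subsets-complete)
    (continuations-unique k n 0)
    (∈continuations⁺ n ∘ partition⇒continuation)
    (continuation⇒partition ∘ ∈continuations⁻ n)

  -- Fibonacci permutations

  map-injective : {A B : Set} {f : A → B} → Injective _≡_ _≡_ f → {u v : Vec A n} →
                  Vec.map f u ≡ Vec.map f v → u ≡ v
  map-injective {f = f} inj {u} {v} eq = lookup-ext λ i → inj (begin
    f (lookup u i)            ≡⟨ Vec.lookup-map i f u ⟨
    lookup (Vec.map f u) i    ≡⟨ cong (λ w → lookup w i) eq ⟩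
    lookup (Vec.map f v) i    ≡⟨ Vec.lookup-map i f v ⟩
    f (lookup v i)            ∎)
    where open ≡-Reasoning

  fixFirst : Vec (Fin k) k → Vec (Fin (suc k)) (suc k)
  fixFirst σ = zero ∷ Vec.map suc σ

  swapFirst : Vec (Fin k) k → Vec (Fin (suc (suc k))) (suc (suc k))
  swapFirst σ = suc zero ∷ zero ∷ Vec.map (suc ∘′ suc) σ

  -- The first value is 0 or 1. If it is 1, the value 0 can only stand in the second place, so the
  -- permutation begins with a swap. This gives the Fibonacci recurrence with initial values 1, 1.
  fibonacciPermutations : (k : ℕ) → List (Vec (Fin k) k)
  fibonacciPermutations 0             = [ [] ]
  fibonacciPermutations 1             = [ zero ∷ [] ]
  fibonacciPermutations (suc (suc k)) =
    List.map fixFirst (fibonacciPermutations (suc k)) ++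
    List.map swapFirst (fibonacciPermutations k)

  module _ (σ : Vec (Fin k) k) where

    fixFirst⁺ : IsFibonacciPermutation σ → IsFibonacciPermutation (fixFirst σ)
    fixFirst⁺ (isFibonacciPermutation inj surj near) = isFibonacciPermutation inj′ surj′ near′
      where
      inj′ : Injective _≡_ _≡_ (lookup (fixFirst σ))
      inj′ {zero}  {zero}  _  = refl
      inj′ {zero}  {suc j} eq = contradiction (trans eq (Vec.lookup-map j suc σ)) λ ()
      inj′ {suc i} {zero}  eq = contradiction (trans (sym eq) (Vec.lookup-map i suc σ)) λ ()
      inj′ {suc i} {suc j} eq = cong suc (inj (Fin.suc-injective
        (trans (sym (Vec.lookup-map i suc σ)) (trans eq (Vec.lookup-map j suc σ)))))
      surj′ : ∀ j → ∃ λ i → lookup (fixFirst σ) i ≡ j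
      surj′ zero    = zero , refl
      surj′ (suc j) = let i , eq = surj j in suc i , trans (Vec.lookup-map i suc σ) (cong suc eq)
      near′ : ∀ i → ∣ toℕ (lookup (fixFirst σ) i) - toℕ i ∣ ≤ 1
      near′ zero    = z≤n
      near′ (suc i) = subst (λ x → ∣ toℕ x - suc (toℕ i) ∣ ≤ 1) (sym (Vec.lookup-map i suc σ)) (near i)

    fixFirst⁻ : IsFibonacciPermutation (fixFirst σ) → IsFibonacciPermutation σ
    fixFirst⁻ (isFibonacciPermutation inj surj near) = isFibonacciPermutation
      (λ {i} {j} eq → Fin.suc-injective (inj {suc i} {suc j}
        (trans (Vec.lookup-map i suc σ) (trans (cong suc eq) (sym (Vec.lookup-map j suc σ))))))
      (λ j → surj′ j (surj (suc j)))
      (λ i → subst (λ x → ∣ toℕ x - suc (toℕ i) ∣ ≤ 1) (Vec.lookup-map i suc σ) (near (suc i)))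
      where
      surj′ : ∀ j → (∃ λ i → lookup (fixFirst σ) i ≡ suc j) → ∃ λ i → lookup σ i ≡ j
      surj′ j (suc i , eq) = i , Fin.suc-injective (trans (sym (Vec.lookup-map i suc σ)) eq)

    private
      lookup-swap : ∀ i → lookup (swapFirst σ) (suc (suc i)) ≡ suc (suc (lookup σ i))
      lookup-swap i = Vec.lookup-map i (suc ∘′ suc) σ

    swapFirst⁺ : IsFibonacciPermutation σ → IsFibonacciPermutation (swapFirst σ)
    swapFirst⁺ (isFibonacciPermutation inj surj near) = isFibonacciPermutation inj′ surj′ near′
      where
      inj′ : Injective _≡_ _≡_ (lookup (swapFirst σ))
      inj′ {zero}        {zero}        _  = refl
      inj′ {suc zero}    {suc zero}    _  = refl
      inj′ {zero}        {suc (suc j)} eq = contradiction (trans eq (lookup-swap j)) λ ()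
      inj′ {suc zero}    {suc (suc j)} eq = contradiction (trans eq (lookup-swap j)) λ ()
      inj′ {suc (suc i)} {zero}        eq = contradiction (trans (sym eq) (lookup-swap i)) λ ()
      inj′ {suc (suc i)} {suc zero}    eq = contradiction (trans (sym eq) (lookup-swap i)) λ ()
      inj′ {suc (suc i)} {suc (suc j)} eq = cong (suc ∘′ suc) (inj (Fin.suc-injective (Fin.suc-injective
        (trans (sym (lookup-swap i)) (trans eq (lookup-swap j))))))
      surj′ : ∀ j → ∃ λ i → lookup (swapFirst σ) i ≡ j
      surj′ zero          = suc zero , refl
      surj′ (suc zero)    = zero , refl
      surj′ (suc (suc j)) =
        let i , eq = surj j in suc (suc i) , trans (lookup-swap i) (cong (suc ∘′ suc) eq)
      near′ : ∀ i → ∣ toℕ (lookup (swapFirst σ) i) - toℕ i ∣ ≤ 1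
      near′ zero          = s≤s z≤n
      near′ (suc zero)    = s≤s z≤n
      near′ (suc (suc i)) =
        subst (λ x → ∣ toℕ x - suc (suc (toℕ i)) ∣ ≤ 1) (sym (lookup-swap i)) (near i)

    swapFirst⁻ : IsFibonacciPermutation (swapFirst σ) → IsFibonacciPermutation σ
    swapFirst⁻ (isFibonacciPermutation inj surj near) = isFibonacciPermutation
      (λ {i} {j} eq → Fin.suc-injective (Fin.suc-injective (inj {suc (suc i)} {suc (suc j)}
        (trans (lookup-swap i) (trans (cong (suc ∘′ suc) eq) (sym (lookup-swap j)))))))
      (λ j → surj′ j (surj (suc (suc j))))
      (λ i → subst (λ x → ∣ toℕ x - suc (suc (toℕ i)) ∣ ≤ 1) (lookup-swap i) (near (suc (suc i))))
      where
      surj′ : ∀ j → (∃ λ i → lookup (swapFirst σ) i ≡ suc (suc j)) → ∃ λ i → lookup σ i ≡ j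
      surj′ j (suc (suc i) , eq) =
        i , Fin.suc-injective (Fin.suc-injective (trans (sym (lookup-swap i)) eq))

  map-suc⁻ : (v : Vec (Fin (suc n)) k) → (∀ i → lookup v i ≢ zero) → ∃ λ w → v ≡ Vec.map suc w
  map-suc⁻ []          _  = [] , refl
  map-suc⁻ (zero  ∷ v) ≢0 = contradiction refl (≢0 zero)
  map-suc⁻ (suc x ∷ v) ≢0 with w , refl ← map-suc⁻ v (≢0 ∘ suc) = x ∷ w , refl

  -- The value `zero` must occur somewhere; the first place is taken, and from the third place on it
  -- would be displaced by at least 2.
  second≡zero : ∀ {x} {σ : Vec (Fin (suc (suc k))) k} →
                IsFibonacciPermutation (suc zero ∷ x ∷ σ) → x ≡ zero
  second≡zero {x = x} {σ} (isFibonacciPermutation _ surjective near) = at (surjective zero)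
    where
    at : (∃ λ i → lookup (suc zero ∷ x ∷ σ) i ≡ zero) → x ≡ zero
    at (suc zero    , eq) = eq
    at (suc (suc i) , eq)
      with s≤s () ← subst (λ y → ∣ toℕ y - suc (suc (toℕ i)) ∣ ≤ 1) eq (near (suc (suc i)))

  -- Injectivity keeps the values used at the front out of the tail. After a fixed 0 the tail is one
  -- `Vec.map suc`; after the swap both 0 and 1 are excluded, so `map-suc⁻` applies twice.
  ∈fibonacciPermutations-suc²⁺ :
    (∀ τ → IsFibonacciPermutation τ → τ ∈ₗ fibonacciPermutations (suc k)) →
    (∀ τ → IsFibonacciPermutation τ → τ ∈ₗ fibonacciPermutations k) →
    ∀ σ → IsFibonacciPermutation σ → σ ∈ₗ fibonacciPermutations (suc (suc k))
  ∈fibonacciPermutations-suc²⁺ ∈¹ ∈⁰ (zero ∷ σ) F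
    with τ , refl ← map-suc⁻ σ (λ i eq →
           contradiction (IsFibonacciPermutation.injective F {zero} {suc i} (sym eq)) λ ())
    = ∈-++⁺ˡ (∈-map⁺ fixFirst (∈¹ τ (fixFirst⁻ τ F)))
  ∈fibonacciPermutations-suc²⁺ {k} ∈¹ ∈⁰ (suc zero ∷ x ∷ σ) F
    with refl ← second≡zero F
    with τ , refl ← map-suc⁻ σ (λ i eq →
           contradiction (IsFibonacciPermutation.injective F {suc zero} {suc (suc i)} (sym eq)) λ ())
    with υ , refl ← map-suc⁻ τ (λ i eq →
           contradiction (IsFibonacciPermutation.injective F {zero} {suc (suc i)}
             (trans (cong suc (sym eq)) (sym (Vec.lookup-map i suc τ)))) λ ())
    -- `swapFirst` shifts by two in one map, whereas stripping the values has produced two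
    -- successive maps.
    = subst (λ τ → (suc zero ∷ zero ∷ τ) ∈ₗ fibonacciPermutations (suc (suc k)))
        (Vec.map-∘ suc suc υ)
        (∈-++⁺ʳ _ (∈-map⁺ swapFirst (∈⁰ υ (swapFirst⁻ υ
          (subst (λ τ → IsFibonacciPermutation (suc zero ∷ zero ∷ τ)) (sym (Vec.map-∘ suc suc υ)) F)))))
  ∈fibonacciPermutations-suc²⁺ ∈¹ ∈⁰ (suc (suc x) ∷ σ) F
    with s≤s () ← IsFibonacciPermutation.near F zero

  ∈fibonacciPermutations⁺ : ∀ k (σ : Vec (Fin k) k) → IsFibonacciPermutation σ →
                            σ ∈ₗ fibonacciPermutations k
  ∈fibonacciPermutations⁺ 0 [] _          = here refl
  ∈fibonacciPermutations⁺ 1 (zero ∷ []) _ = here refl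
  ∈fibonacciPermutations⁺ (suc (suc k))   =
    ∈fibonacciPermutations-suc²⁺ (∈fibonacciPermutations⁺ (suc k)) (∈fibonacciPermutations⁺ k)

  ∈fibonacciPermutations-suc²⁻ :
    (∀ {τ} → τ ∈ₗ fibonacciPermutations (suc k) → IsFibonacciPermutation τ) →
    (∀ {τ} → τ ∈ₗ fibonacciPermutations k → IsFibonacciPermutation τ) →
    ∀ {σ} → σ ∈ₗ fibonacciPermutations (suc (suc k)) → IsFibonacciPermutation σ
  ∈fibonacciPermutations-suc²⁻ {k} fib¹ fib⁰ σ∈
    with ∈-++⁻ (List.map fixFirst (fibonacciPermutations (suc k))) σ∈
  ... | inj₁ σ∈ˡ with τ , τ∈ , refl ← ∈-map⁻ fixFirst σ∈ˡ = fixFirst⁺ τ (fib¹ τ∈)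
  ... | inj₂ σ∈ʳ with τ , τ∈ , refl ← ∈-map⁻ swapFirst σ∈ʳ = swapFirst⁺ τ (fib⁰ τ∈)

  ∈fibonacciPermutations⁻ : (k : ℕ) {σ : Vec (Fin k) k} → σ ∈ₗ fibonacciPermutations k →
                            IsFibonacciPermutation σ
  ∈fibonacciPermutations⁻ 0 (here refl) =
    isFibonacciPermutation (λ { {()} }) (λ ()) (λ ())
  ∈fibonacciPermutations⁻ 1 (here refl) =
    fixFirst⁺ [] (∈fibonacciPermutations⁻ 0 (here refl))
  ∈fibonacciPermutations⁻ (suc (suc k)) =
    ∈fibonacciPermutations-suc²⁻ (∈fibonacciPermutations⁻ (suc k)) (∈fibonacciPermutations⁻ k)

  fibonacciPermutations-unique : ∀ k → Unique (fibonacciPermutations k)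
  fibonacciPermutations-unique 0 = All.[] ∷ []
  fibonacciPermutations-unique 1 = All.[] ∷ []
  fibonacciPermutations-unique (suc (suc k)) = Unique.++⁺
    (Unique.map⁺ (map-injective Fin.suc-injective ∘ Vec.∷-injectiveʳ)
      (fibonacciPermutations-unique (suc k)))
    (Unique.map⁺ (map-injective (Fin.suc-injective ∘ Fin.suc-injective)
                   ∘ Vec.∷-injectiveʳ ∘ Vec.∷-injectiveʳ)
      (fibonacciPermutations-unique k))
    disjoint
    where
    disjoint : ∀ {σ} → ¬ (σ ∈ₗ List.map fixFirst (fibonacciPermutations (suc k)) ×
                          σ ∈ₗ List.map swapFirst (fibonacciPermutations k))
    disjoint (p , q) with _ , _ , refl ← ∈-map⁻ fixFirst p with _ , _ , () ← ∈-map⁻ swapFirst q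

  #fibonacciPermutations : ℕ → ℕ
  #fibonacciPermutations k = length (fibonacciPermutations k)

  #fibonacciPermutations-suc² : ∀ k → #fibonacciPermutations (suc (suc k)) ≡
                                #fibonacciPermutations (suc k) ℕ.+ #fibonacciPermutations k
  #fibonacciPermutations-suc² k = trans (List.length-++ (List.map fixFirst (fibonacciPermutations (suc k))))
    (cong₂ ℕ._+_ (List.length-map fixFirst (fibonacciPermutations (suc k)))
               (List.length-map swapFirst (fibonacciPermutations k)))

  -- Recovering partition and permutation from an arrangement

  increasing⇒inflationary : (f : Fin k → Fin k) → (∀ {i j} → i Fin.< j → f i Fin.< f j) →
                            ∀ i → i Fin.≤ f i
  increasing⇒inflationary {suc k} f f-mono = <-weakInduction (λ i → i Fin.≤ f i) z≤n λ i i≤fi →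
    ℕ.≤-trans (s≤s (subst (_≤ toℕ (f (inject₁ i))) (Fin.toℕ-inject₁ i) i≤fi))
              (f-mono (s≤s (ℕ.≤-reflexive (Fin.toℕ-inject₁ i))))

  ◁-asym : {s t : Subset n} → s ◁ t → ¬ t ◁ s
  ◁-asym (x , x∈s , x<) (y , y∈t , y<) = ℕ.<-asym (x< y y∈t) (y< x x∈s)

  module _ {B : Vec (Subset n) k} (C : IsContinuation 0 B) where
    open IsContinuation C

    lookup-injective : ∀ {i j} → lookup B i ≡ lookup B j → i ≡ j
    lookup-injective {i} eq =
      let x , x∈ = nonempty i z≤n in disjoint x∈ (subst (x ∈_) eq x∈)

    -- If f i = f j, block j would precede itself; if f j < f i, blocks i and j would precede each
    -- other. Asymmetry of `◁` excludes both.
    reindexing-increasing : {B′ : Vec (Subset n) k} → IsContinuation 0 B′ → (f : Fin k → Fin k) →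
                            (∀ i → lookup B i ≡ lookup B′ (f i)) →
                            ∀ {i j} → i Fin.< j → f i Fin.< f j
    reindexing-increasing {B′} C′ f eq {i} {j} i<j with Fin.<-cmp (f i) (f j)
    ... | tri< fi<fj _ _ = fi<fj
    ... | tri≈ _ fi≡fj _ = contradiction s (◁-asym s)
      where
      s : lookup B j ◁ lookup B j
      s = subst (_◁ lookup B j)
            (trans (eq i) (trans (cong (lookup B′) fi≡fj) (sym (eq j)))) (sorted z≤n i<j)
    ... | tri> _ _ fj<fi = contradiction
      (subst₂ _◁_ (sym (eq j)) (sym (eq i)) (IsContinuation.sorted C′ z≤n fj<fi))
      (◁-asym (sorted z≤n i<j))

  -- The matchings f and g of the two listings are increasing, hence inflationary, and g (f i) = i
  -- because distinct indices carry distinct blocks. Thus i ≤ f i ≤ g (f i) = i.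
  same-blocks⇒≡ : {B B′ : Vec (Subset n) k} → IsContinuation 0 B → IsContinuation 0 B′ →
                  (∀ i → ∃ λ j → lookup B i ≡ lookup B′ j) →
                  (∀ i → ∃ λ j → lookup B′ i ≡ lookup B j) → B ≡ B′
  same-blocks⇒≡ {B = B} {B′} C C′ to from = lookup-ext λ i → trans (f-eq i) (cong (lookup B′) (f≡id i))
    where
    f    = proj₁ ∘ to
    f-eq = proj₂ ∘ to
    g    = proj₁ ∘ from
    g-eq = proj₂ ∘ from
    f≡id : ∀ i → f i ≡ i
    f≡id i = Fin.≤-antisym
      (subst (f i Fin.≤_) (sym (lookup-injective C (trans (f-eq i) (g-eq (f i)))))
        (increasing⇒inflationary g (reindexing-increasing C′ C g g-eq) (f i)))
      (increasing⇒inflationary f (reindexing-increasing C C′ f f-eq) i)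

  arrange : Vec (Subset n) k × Vec (Fin k) k → Vec (Subset n) k
  arrange (B , σ) = Vec.map (lookup B) σ

  -- A surjective σ displays every block, so the arrangement determines the set of blocks and with
  -- it the sorted listing. Once the listings agree, distinctness of the blocks determines σ.
  arrange-injective : {B B′ : Vec (Subset n) k} {σ σ′ : Vec (Fin k) k} →
                      IsContinuation 0 B → IsContinuation 0 B′ →
                      IsFibonacciPermutation σ → IsFibonacciPermutation σ′ →
                      arrange (B , σ) ≡ arrange (B′ , σ′) → (B , σ) ≡ (B′ , σ′)
  arrange-injective {B = B} {B′} {σ} {σ′} C C′ F F′ eq = conclude B≡B′ σ≡
    where
    open IsFibonacciPermutation
    open ≡-Reasoning
    eq-at : ∀ i → lookup B (lookup σ i) ≡ lookup B′ (lookup σ′ i)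
    eq-at i = begin
      lookup B (lookup σ i)           ≡⟨ Vec.lookup-map i (lookup B) σ ⟨
      lookup (arrange (B , σ)) i      ≡⟨ cong (λ D → lookup D i) eq ⟩
      lookup (arrange (B′ , σ′)) i    ≡⟨ Vec.lookup-map i (lookup B′) σ′ ⟩
      lookup B′ (lookup σ′ i)         ∎
    B≡B′ : B ≡ B′
    B≡B′ = same-blocks⇒≡ C C′
      (λ j → let i , σi≡j = surjective F j
             in lookup σ′ i , trans (cong (lookup B) (sym σi≡j)) (eq-at i))
      (λ j → let i , σ′i≡j = surjective F′ j
             in lookup σ i , trans (cong (lookup B′) (sym σ′i≡j)) (sym (eq-at i)))
    σ≡ : B ≡ B′ → σ ≡ σ′
    σ≡ refl = lookup-ext λ i → lookup-injective C (eq-at i)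
    conclude : B ≡ B′ → (B ≡ B′ → σ ≡ σ′) → (B , σ) ≡ (B′ , σ′)
    conclude refl τ = cong (B ,_) (τ refl)

  #orderedPartitions : ∀ n k → count isFibonacciOrderedPartition? (words (subsets n) k) ≡
                       #continuations k n 0 ℕ.* #fibonacciPermutations k
  #orderedPartitions n k = begin
    count isFibonacciOrderedPartition? (words (subsets n) k)
      ≡⟨ count≡length isFibonacciOrderedPartition?
           (words-unique (subsets-unique n) k) (words-complete subsets-complete)
           (map-unique inj (Unique.cartesianProduct⁺ (continuations-unique k n 0)
                                                     (fibonacciPermutations-unique k)))
           to from ⟩
    length (List.map arrange pairs)
      ≡⟨ List.length-map arrange pairs ⟩
    length pairs
      ≡⟨ length-cartesianProductWith _,_ (continuations k n 0) (fibonacciPermutations k) ⟩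
    #continuations k n 0 ℕ.* #fibonacciPermutations k ∎
    where
    open ≡-Reasoning
    pairs : List (Vec (Subset n) k × Vec (Fin k) k)
    pairs = cartesianProduct (continuations k n 0) (fibonacciPermutations k)
    valid : ∀ {B σ} → (B , σ) ∈ₗ pairs → IsContinuation 0 B × IsFibonacciPermutation σ
    valid p∈ = let B∈ , σ∈ = ∈-cartesianProduct⁻ (continuations k n 0) (fibonacciPermutations k) p∈
               in ∈continuations⁻ n B∈ , ∈fibonacciPermutations⁻ k σ∈
    inj : ∀ {p q} → p ∈ₗ pairs → q ∈ₗ pairs → arrange p ≡ arrange q → p ≡ q
    inj p∈ q∈ = let C , F = valid p∈ ; C′ , F′ = valid q∈ in arrange-injective C C′ F F′
    to : ∀ {D} → IsFibonacciOrderedPartition D → D ∈ₗ List.map arrange pairs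
    to (B , σ , P , F , refl) = ∈-map⁺ arrange (∈-cartesianProduct⁺
      (∈continuations⁺ n (partition⇒continuation P)) (∈fibonacciPermutations⁺ k σ F))
    from : ∀ {D} → D ∈ₗ List.map arrange pairs → IsFibonacciOrderedPartition D
    from D∈ with (B , σ) , p∈ , refl ← ∈-map⁻ arrange D∈ =
      let C , F = valid p∈ in B , σ , continuation⇒partition C , F , refl

  𝓕≡sum : ∀ n → 𝓕 n ≡
           sum (List.map (λ k → #continuations k n 0 ℕ.* #fibonacciPermutations k) (upTo (suc n)))
  𝓕≡sum n = cong sum (List.map-cong (#orderedPartitions n) (upTo (suc n)))

open OrderedPartitions

-- Finite sums and cancellation in the field

module FieldProperties {c ℓ₁ ℓ₂} (K : HeytingField c ℓ₁ ℓ₂) where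
  open Field K public hiding (zero)
  open CommutativeRing commutativeRing public
    using (ring; +-commutativeMonoid; commutativeSemiring)
  open import Algebra.Apartness.Properties.HeytingCommutativeRing
    heytingCommutativeRing public using (x-0≈x)
  open import Algebra.Properties.Monoid.Mult +-monoid public using (×-homo-+)
  open import Algebra.Properties.Semiring.Mult semiring public using (×1-homo-*)
  open import Algebra.Properties.CommutativeMonoid.Sum +-commutativeMonoid public
    using (sum-syntax; sum⁺-syntax; sum-cong-≋; sum-replicate-zero; ∑-distrib-+; ∑-comm)
  open import Algebra.Properties.Semiring.Sum semiring public using (*-distribˡ-sum)
  open import Algebra.Solver.Ring.NaturalCoefficients.Default commutativeSemiring public
    using (solve; con; _:+_; _:*_; _:=_)
  open import Relation.Binary.Reasoning.Setoid setoid public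

  sum-zero : ∀ {N} (f : Fin N → Carrier) → (∀ i → f i ≈ 0#) → ∑[ i < N ] f i ≈ 0#
  sum-zero {N} f f≈0 = trans (sum-cong-≋ f≈0) (sum-replicate-zero N)

  sum-truncate : ∀ {M N} (f : ℕ → Carrier) → (∀ k → M ≤ k → f k ≈ 0#) → M ≤ N →
                 ∑[ k < N ] f (toℕ k) ≈ ∑[ k < M ] f (toℕ k)
  sum-truncate {N = N} f f≈0 z≤n = sum-zero {N} (f ∘ toℕ) λ k → f≈0 (toℕ k) z≤n
  sum-truncate f f≈0 (s≤s M≤N) = +-congˡ (sum-truncate (f ∘ suc) (λ k → f≈0 (suc k) ∘ s≤s) M≤N)

  sum-single : ∀ {m N} (f : ℕ → Carrier) → (∀ k → k ≢ m → f k ≈ 0#) → m < N →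
               ∑[ k < N ] f (toℕ k) ≈ f m
  sum-single {zero} {suc N} f f≈0 (s≤s _) = trans
    (+-congˡ (sum-zero {N} (f ∘ suc ∘ toℕ) λ k → f≈0 (suc (toℕ k)) λ ())) (+-identityʳ _)
  sum-single {suc m} f f≈0 (s≤s m<N) = trans
    (+-cong (f≈0 0 λ ())
            (sum-single (f ∘ suc) (λ k k≢m → f≈0 (suc k) (k≢m ∘ ℕ.suc-injective)) m<N))
    (+-identityˡ _)

  recip-inverseˡ : ∀ {x} (x#0 : x # 0#) → recip x#0 * x ≈ 1#
  recip-inverseˡ {x} x#0 =
    trans (*-congˡ (sym (x-0≈x x))) (proj₁ (proj₂ (#⇒invertible x#0)))

  #0-cancelˡ : ∀ {x y z} → x # 0# → x * y ≈ x * z → y ≈ z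
  #0-cancelˡ {x} {y} {z} x#0 xy≈xz = begin
    y                     ≈⟨ *-identityˡ y ⟨
    1# * y                ≈⟨ *-congʳ (recip-inverseˡ x#0) ⟨
    recip x#0 * x * y     ≈⟨ *-assoc _ x y ⟩
    recip x#0 * (x * y)   ≈⟨ *-congˡ xy≈xz ⟩
    recip x#0 * (x * z)   ≈⟨ *-assoc _ x z ⟨
    recip x#0 * x * z     ≈⟨ *-congʳ (recip-inverseˡ x#0) ⟩
    1# * z                ≈⟨ *-identityˡ z ⟩
    z                     ∎

  fromℕ-+ : ∀ m n → fromℕ (m ℕ.+ n) ≈ fromℕ m + fromℕ n
  fromℕ-+ m n = ×-homo-+ 1# m n

  fromℕ-* : ∀ m n → fromℕ (m ℕ.* n) ≈ fromℕ m * fromℕ n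
  fromℕ-* = ×1-homo-*

  -- Brings subtraction within reach of the solver for commutative semirings, to which -1 is just
  -- another variable.
  x-y≈x+[-1]y : ∀ x y → x - y ≈ x + (- 1#) * y
  x-y≈x+[-1]y x y = +-congˡ (sym (-1*x≈-x y))
    where open import Algebra.Properties.Ring ring using (-1*x≈-x)

-- Cauchy products of formal power series

module PowerSeriesProperties {c ℓ₁ ℓ₂} (K : HeytingField c ℓ₁ ℓ₂)
                             (char0 : CharacteristicZero K) where
  open FieldProperties K
  open PowerSeries K char0

  infixl 6 _⊕_

  _⊕_ : Series → Series → Series
  (f ⊕ g) n = f n + g n

  tail : Series → Series
  tail f n = f (suc n)

  private variable
    f f′ g g′ : Series

  ⊛-cong : f ≋ f′ → g ≋ g′ → f ⊛ g ≋ f′ ⊛ g′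
  ⊛-cong f≋f′ g≋g′ n = sum-cong-≋ {suc n} λ i → *-cong (f≋f′ (toℕ i)) (g≋g′ (n ∸ toℕ i))

  ⊛-congˡ : ∀ f {g g′} → g ≋ g′ → f ⊛ g ≋ f ⊛ g′
  ⊛-congˡ f g≋g′ = ⊛-cong {f} {f} (λ _ → refl) g≋g′

  ⊛-congʳ : ∀ g {f f′} → f ≋ f′ → f ⊛ g ≋ f′ ⊛ g
  ⊛-congʳ g f≋f′ = ⊛-cong {g = g} {g} f≋f′ (λ _ → refl)

  ⊛-zeroˡ : ∀ f → (∀ n → f n ≈ 0#) → ∀ g n → (f ⊛ g) n ≈ 0#
  ⊛-zeroˡ f f≈0 g n = sum-zero {suc n} (λ i → f (toℕ i) * g (n ∸ toℕ i)) λ i → trans (*-congʳ (f≈0 (toℕ i))) (zeroˡ _)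

  ⊛-distribʳ : ∀ f g h → (f ⊕ g) ⊛ h ≋ f ⊛ h ⊕ g ⊛ h
  ⊛-distribʳ f g h n = trans
    (sum-cong-≋ {suc n} λ i → distribʳ (h (n ∸ toℕ i)) (f (toℕ i)) (g (toℕ i)))
    (∑-distrib-+ {suc n} (λ i → f (toℕ i) * h (n ∸ toℕ i)) (λ i → g (toℕ i) * h (n ∸ toℕ i)))

  •-⊛ : ∀ x f g → (x • f) ⊛ g ≋ x • (f ⊛ g)
  •-⊛ x f g n = trans
    (sum-cong-≋ {suc n} λ i → *-assoc x (f (toℕ i)) (g (n ∸ toℕ i)))
    (sym (*-distribˡ-sum {suc n} x (λ i → f (toℕ i) * g (n ∸ toℕ i))))

  -- By definition the convolution splits off the term with `f 0`; this is the mirror image,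
  -- splitting off `g 0`. Commutativity and the product rule rest on having both.
  ⊛-sucʳ : ∀ f g n → (f ⊛ g) (suc n) ≈ f (suc n) * g 0 + (f ⊛ tail g) n
  ⊛-sucʳ f g zero    = solve 4 (λ a b c d →
    a :* d :+ (b :* c :+ con 0) := b :* c :+ (a :* d :+ con 0)) refl (f 0) (f 1) (g 0) (g 1)
  ⊛-sucʳ f g (suc n) = begin
    f 0 * g (suc (suc n)) + (tail f ⊛ g) (suc n)
      ≈⟨ +-congˡ (⊛-sucʳ (tail f) g n) ⟩
    f 0 * g (suc (suc n)) + (f (suc (suc n)) * g 0 + (tail f ⊛ tail g) n)
      ≈⟨ solve 3 (λ a b c → a :+ (b :+ c) := b :+ (a :+ c)) refl _ _ _ ⟩
    f (suc (suc n)) * g 0 + (f 0 * g (suc (suc n)) + (tail f ⊛ tail g) n) ∎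

  ⊛-comm : ∀ f g → f ⊛ g ≋ g ⊛ f
  ⊛-comm f g zero    = +-congʳ (*-comm (f 0) (g 0))
  ⊛-comm f g (suc n) = begin
    f 0 * g (suc n) + (tail f ⊛ g) n    ≈⟨ +-cong (*-comm _ _) (⊛-comm (tail f) g n) ⟩
    g (suc n) * f 0 + (g ⊛ tail f) n    ≈⟨ ⊛-sucʳ g f n ⟨
    (g ⊛ f) (suc n)                     ∎

  ⊛-assoc : ∀ f g h → (f ⊛ g) ⊛ h ≋ f ⊛ (g ⊛ h)
  ⊛-assoc f g h zero    = solve 3 (λ a b c →
    (a :* b :+ con 0) :* c :+ con 0 := a :* (b :* c :+ con 0) :+ con 0) refl (f 0) (g 0) (h 0)
  ⊛-assoc f g h (suc n) = begin
    -- `tail (f ⊛ g)` unfolds to `f 0 • tail g ⊕ tail f ⊛ g`.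
    (f 0 * g 0 + 0#) * h (suc n) + ((f 0 • tail g ⊕ tail f ⊛ g) ⊛ h) n
      ≈⟨ +-congˡ (trans (⊛-distribʳ (f 0 • tail g) (tail f ⊛ g) h n)
                        (+-cong (•-⊛ (f 0) (tail g) h n) (⊛-assoc (tail f) g h n))) ⟩
    (f 0 * g 0 + 0#) * h (suc n) + (f 0 * (tail g ⊛ h) n + (tail f ⊛ (g ⊛ h)) n)
      ≈⟨ solve 5 (λ a b c d e →
           (a :* b :+ con 0) :* c :+ (a :* d :+ e) := a :* (b :* c :+ d) :+ e) refl _ _ _ _ _ ⟩
    f 0 * (g 0 * h (suc n) + (tail g ⊛ h) n) + (tail f ⊛ (g ⊛ h)) n ∎

  ⊛-distribˡ : ∀ f g h → f ⊛ (g ⊕ h) ≋ f ⊛ g ⊕ f ⊛ h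
  ⊛-distribˡ f g h n = begin
    (f ⊛ (g ⊕ h)) n           ≈⟨ ⊛-comm f (g ⊕ h) n ⟩
    ((g ⊕ h) ⊛ f) n           ≈⟨ ⊛-distribʳ g h f n ⟩
    (g ⊛ f) n + (h ⊛ f) n     ≈⟨ +-cong (⊛-comm g f n) (⊛-comm h f n) ⟩
    (f ⊛ g) n + (f ⊛ h) n     ∎

  ⊛-• : ∀ x f g → f ⊛ (x • g) ≋ x • (f ⊛ g)
  ⊛-• x f g n = begin
    (f ⊛ (x • g)) n     ≈⟨ ⊛-comm f (x • g) n ⟩
    ((x • g) ⊛ f) n     ≈⟨ •-⊛ x g f n ⟩
    x * (g ⊛ f) n       ≈⟨ *-congˡ (⊛-comm g f n) ⟩
    x * (f ⊛ g) n       ∎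

  ⊛-identityˡ : ∀ f → 𝟙 ⊛ f ≋ f
  ⊛-identityˡ f zero    = trans (+-identityʳ _) (*-identityˡ _)
  ⊛-identityˡ f (suc n) =
    trans (+-cong (*-identityˡ _) (⊛-zeroˡ (tail 𝟙) (λ _ → refl) f n)) (+-identityʳ _)

  ⊛-constant : ∀ f g → f 0 ≈ 1# → g 0 ≈ 1# → (f ⊛ g) 0 ≈ 1#
  ⊛-constant f g f₀≈1 g₀≈1 = trans (+-identityʳ _) (trans (*-cong f₀≈1 g₀≈1) (*-identityˡ 1#))

  -- Derivation and exponential

  ∂-cong : ∀ {f g} → f ≋ g → ∂ f ≋ ∂ g
  ∂-cong f≋g n = *-congˡ (f≋g (suc n))

  ∂-⊕ : ∀ f g → ∂ (f ⊕ g) ≋ ∂ f ⊕ ∂ g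
  ∂-⊕ f g n = distribˡ _ _ _

  ∂-• : ∀ x f → ∂ (x • f) ≋ x • ∂ f
  ∂-• x f n = solve 3 (λ a b c → a :* (b :* c) := b :* (a :* c)) refl _ _ _

  ∂𝟙≈0 : ∀ n → ∂ 𝟙 n ≈ 0#
  ∂𝟙≈0 n = zeroʳ _

  -- Unlike ∂, the Euler operator t·d/dt acts on coefficients without a shift,
  -- and the product rule for it holds summand by summand.
  θ : Series → Series
  θ f n = fromℕ n * f n

  θ-⊛ : ∀ f g → θ (f ⊛ g) ≋ θ f ⊛ g ⊕ f ⊛ θ g
  θ-⊛ f g n = begin
    fromℕ n * (f ⊛ g) n
      ≈⟨ *-distribˡ-sum {suc n} (fromℕ n) (λ i → f (toℕ i) * g (n ∸ toℕ i)) ⟩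
    ∑[ i ≤ n ] (fromℕ n * (f (toℕ i) * g (n ∸ toℕ i)))
      ≈⟨ sum-cong-≋ {suc n} summand ⟩
    ∑[ i ≤ n ] (θ f (toℕ i) * g (n ∸ toℕ i) + f (toℕ i) * θ g (n ∸ toℕ i))
      ≈⟨ ∑-distrib-+ {suc n} (λ i → θ f (toℕ i) * g (n ∸ toℕ i)) (λ i → f (toℕ i) * θ g (n ∸ toℕ i)) ⟩
    (θ f ⊛ g) n + (f ⊛ θ g) n ∎
    where
    summand : ∀ (i : Fin (suc n)) → fromℕ n * (f (toℕ i) * g (n ∸ toℕ i)) ≈
              θ f (toℕ i) * g (n ∸ toℕ i) + f (toℕ i) * θ g (n ∸ toℕ i)
    summand i = begin
      fromℕ n * (f (toℕ i) * g (n ∸ toℕ i))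
        ≡⟨ ≡.cong (λ m → fromℕ m * (f (toℕ i) * g (n ∸ toℕ i)))
             (ℕ.m+[n∸m]≡n (Fin.toℕ≤pred[n] i)) ⟨
      fromℕ (toℕ i ℕ.+ (n ∸ toℕ i)) * (f (toℕ i) * g (n ∸ toℕ i))
        ≈⟨ *-congʳ (fromℕ-+ (toℕ i) (n ∸ toℕ i)) ⟩
      (fromℕ (toℕ i) + fromℕ (n ∸ toℕ i)) * (f (toℕ i) * g (n ∸ toℕ i))
        ≈⟨ solve 4 (λ a b c d →
             (a :+ b) :* (c :* d) := a :* c :* d :+ c :* (b :* d)) refl _ _ _ _ ⟩
      θ f (toℕ i) * g (n ∸ toℕ i) + f (toℕ i) * θ g (n ∸ toℕ i) ∎

  -- `∂ f` is `θ f` shifted by one place, so this is the rule for `θ` in degree n + 1; the two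
  -- boundary terms contain `θ f 0` and `θ g 0`, which vanish.
  ∂-⊛ : ∀ f g → ∂ (f ⊛ g) ≋ ∂ f ⊛ g ⊕ f ⊛ ∂ g
  ∂-⊛ f g n = begin
    θ (f ⊛ g) (suc n)
      ≈⟨ θ-⊛ f g (suc n) ⟩
    0# * f 0 * g (suc n) + (∂ f ⊛ g) n + (f ⊛ θ g) (suc n)
      ≈⟨ +-congˡ (⊛-sucʳ f (θ g) n) ⟩
    0# * f 0 * g (suc n) + (∂ f ⊛ g) n + (f (suc n) * (0# * g 0) + (f ⊛ ∂ g) n)
      ≈⟨ solve 6 (λ a b c d p q →
           con 0 :* a :* b :+ p :+ (c :* (con 0 :* d) :+ q) := p :+ q) refl _ _ _ _ _ _ ⟩
    (∂ f ⊛ g) n + (f ⊛ ∂ g) n ∎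

  ∂-^ˢ : ∀ f m → ∂ (f ^ˢ suc m) ≋ fromℕ (suc m) • (∂ f ⊛ f ^ˢ m)
  ∂-^ˢ f zero    n = begin
    ∂ (f ⊛ 𝟙) n                      ≈⟨ ∂-⊛ f 𝟙 n ⟩
    (∂ f ⊛ 𝟙) n + (f ⊛ ∂ 𝟙) n        ≈⟨ +-congˡ (trans (⊛-comm f (∂ 𝟙) n) (⊛-zeroˡ (∂ 𝟙) ∂𝟙≈0 f n)) ⟩
    (∂ f ⊛ 𝟙) n + 0#                 ≈⟨ solve 1 (λ a → a :+ con 0 := (con 1 :+ con 0) :* a) refl _ ⟩
    fromℕ 1 * (∂ f ⊛ 𝟙) n            ∎
  ∂-^ˢ f (suc m) n = begin
    ∂ (f ⊛ f ^ˢ suc m) n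
      ≈⟨ ∂-⊛ f (f ^ˢ suc m) n ⟩
    (∂ f ⊛ f ^ˢ suc m) n + (f ⊛ ∂ (f ^ˢ suc m)) n
      ≈⟨ +-congˡ (⊛-congˡ f (∂-^ˢ f m) n) ⟩
    (∂ f ⊛ f ^ˢ suc m) n + (f ⊛ (fromℕ (suc m) • (∂ f ⊛ f ^ˢ m))) n
      ≈⟨ +-congˡ (⊛-• (fromℕ (suc m)) f (∂ f ⊛ f ^ˢ m) n) ⟩
    (∂ f ⊛ f ^ˢ suc m) n + fromℕ (suc m) * (f ⊛ (∂ f ⊛ f ^ˢ m)) n
      ≈⟨ +-congˡ (*-congˡ swap) ⟩
    (∂ f ⊛ f ^ˢ suc m) n + fromℕ (suc m) * (∂ f ⊛ f ^ˢ suc m) n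
      ≈⟨ solve 2 (λ a b → a :+ b :* a := (con 1 :+ b) :* a) refl _ _ ⟩
    fromℕ (suc (suc m)) * (∂ f ⊛ f ^ˢ suc m) n ∎
    where
    swap : (f ⊛ (∂ f ⊛ f ^ˢ m)) n ≈ (∂ f ⊛ (f ⊛ f ^ˢ m)) n
    swap = begin
      (f ⊛ (∂ f ⊛ f ^ˢ m)) n    ≈⟨ ⊛-assoc f (∂ f) (f ^ˢ m) n ⟨
      (f ⊛ ∂ f ⊛ f ^ˢ m) n      ≈⟨ ⊛-congʳ (f ^ˢ m) (⊛-comm f (∂ f)) n ⟩
      (∂ f ⊛ f ⊛ f ^ˢ m) n      ≈⟨ ⊛-assoc (∂ f) f (f ^ˢ m) n ⟩
      (∂ f ⊛ (f ⊛ f ^ˢ m)) n    ∎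

  ^ˢ-low : ∀ f → f 0 ≈ 0# → ∀ {m n} → n < m → (f ^ˢ m) n ≈ 0#
  ^ˢ-low f f₀≈0 {suc m} {zero}  _         =
    trans (+-identityʳ _) (trans (*-congʳ f₀≈0) (zeroˡ _))
  ^ˢ-low f f₀≈0 {suc m} {suc n} (s≤s n<m) = begin
    f 0 * (f ^ˢ m) (suc n) + (tail f ⊛ f ^ˢ m) n
      ≈⟨ +-cong (trans (*-congʳ f₀≈0) (zeroˡ _))
           (sum-zero {suc n} (λ i → f (suc (toℕ i)) * (f ^ˢ m) (n ∸ toℕ i)) λ i → trans
             (*-congˡ (^ˢ-low f f₀≈0 (ℕ.≤-<-trans (ℕ.m∸n≤m n (toℕ i)) n<m))) (zeroʳ _)) ⟩
    0# + 0# ≈⟨ +-identityʳ 0# ⟩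
    0# ∎

  recip!-inverseˡ : ∀ n → recip! n * fromℕ (n !) ≈ 1#
  recip!-inverseˡ n = recip-inverseˡ (char0 (n !) {{n ℕ.!≢0}})

  recip!-suc : ∀ n → recip! (suc n) * fromℕ (suc n) ≈ recip! n
  recip!-suc n = begin
    recip! (suc n) * fromℕ (suc n)
      ≈⟨ *-identityʳ _ ⟨
    recip! (suc n) * fromℕ (suc n) * 1#
      ≈⟨ *-congˡ (recip!-inverseˡ n) ⟨
    recip! (suc n) * fromℕ (suc n) * (recip! n * fromℕ (n !))
      ≈⟨ solve 4 (λ a b c d → a :* b :* (c :* d) := a :* (b :* d) :* c) refl _ _ _ _ ⟩
    recip! (suc n) * (fromℕ (suc n) * fromℕ (n !)) * recip! n
      ≈⟨ *-congʳ (*-congˡ (fromℕ-* (suc n) (n !))) ⟨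
    recip! (suc n) * fromℕ (suc n !) * recip! n
      ≈⟨ *-congʳ (recip!-inverseˡ (suc n)) ⟩
    1# * recip! n
      ≈⟨ *-identityˡ _ ⟩
    recip! n ∎

  exp-constant : ∀ f → exp f 0 ≈ 1#
  exp-constant f = begin
    recip! 0 * 1# + 0#    ≈⟨ solve 1 (λ r → r :* con 1 :+ con 0 := r :* (con 1 :+ con 0)) refl _ ⟩
    recip! 0 * fromℕ 1    ≈⟨ recip!-inverseˡ 0 ⟩
    1#                    ∎

  -- Allows all coefficients of `exp f` up to degree n to be summed over the same range of m, as the
  -- interchange of sums in `∂-exp` requires.
  exp-truncate : ∀ f → f 0 ≈ 0# → ∀ {j n} → j ≤ n →
                 ∑[ m ≤ n ] (recip! (toℕ m) * (f ^ˢ toℕ m) j) ≈ exp f j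
  exp-truncate f f₀≈0 {j} j≤n = sum-truncate (λ m → recip! m * (f ^ˢ m) j)
    (λ m j<m → trans (*-congˡ (^ˢ-low f f₀≈0 j<m)) (zeroʳ _)) (s≤s j≤n)

  -- The term m = 0 is constant, and term m + 1 differentiates to `∂ f` times fᵐ/m!. Interchanging
  -- the sums over m and over the convolution index then collects the coefficients of `exp f`.
  ∂-exp : ∀ f → f 0 ≈ 0# → ∂ (exp f) ≋ ∂ f ⊛ exp f
  ∂-exp f f₀≈0 n = begin
    fromℕ (suc n) * exp f (suc n)
      ≈⟨ *-distribˡ-sum {suc (suc n)} (fromℕ (suc n))
           (λ m → recip! (toℕ m) * (f ^ˢ toℕ m) (suc n)) ⟩
    fromℕ (suc n) * (recip! 0 * 0#) +
    ∑[ m ≤ n ] (fromℕ (suc n) * (recip! (suc (toℕ m)) * (f ^ˢ suc (toℕ m)) (suc n)))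
      ≈⟨ +-cong (trans (*-congˡ (zeroʳ _)) (zeroʳ _)) (sum-cong-≋ {suc n} (term ∘ toℕ)) ⟩
    0# + ∑[ m ≤ n ] ∑[ i ≤ n ] (∂ f (toℕ i) * (recip! (toℕ m) * (f ^ˢ toℕ m) (n ∸ toℕ i)))
      ≈⟨ +-identityˡ _ ⟩
    ∑[ m ≤ n ] ∑[ i ≤ n ] (∂ f (toℕ i) * (recip! (toℕ m) * (f ^ˢ toℕ m) (n ∸ toℕ i)))
      ≈⟨ ∑-comm {suc n} {suc n}
           (λ m i → ∂ f (toℕ i) * (recip! (toℕ m) * (f ^ˢ toℕ m) (n ∸ toℕ i))) ⟩
    ∑[ i ≤ n ] ∑[ m ≤ n ] (∂ f (toℕ i) * (recip! (toℕ m) * (f ^ˢ toℕ m) (n ∸ toℕ i)))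
      ≈⟨ (sum-cong-≋ {suc n} λ i → trans (sym (*-distribˡ-sum {suc n} (∂ f (toℕ i))
             (λ m → recip! (toℕ m) * (f ^ˢ toℕ m) (n ∸ toℕ i))))
           (*-congˡ (exp-truncate f f₀≈0 (ℕ.m∸n≤m n (toℕ i))))) ⟩
    (∂ f ⊛ exp f) n ∎
    where
    term : ∀ m → fromℕ (suc n) * (recip! (suc m) * (f ^ˢ suc m) (suc n)) ≈
           ∑[ i ≤ n ] (∂ f (toℕ i) * (recip! m * (f ^ˢ m) (n ∸ toℕ i)))
    term m = begin
      fromℕ (suc n) * (recip! (suc m) * (f ^ˢ suc m) (suc n))
        ≈⟨ solve 3 (λ a b c → a :* (b :* c) := b :* (a :* c)) refl _ _ _ ⟩
      recip! (suc m) * ∂ (f ^ˢ suc m) n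
        ≈⟨ *-congˡ (∂-^ˢ f m n) ⟩
      recip! (suc m) * (fromℕ (suc m) * (∂ f ⊛ f ^ˢ m) n)
        ≈⟨ *-assoc _ _ _ ⟨
      recip! (suc m) * fromℕ (suc m) * (∂ f ⊛ f ^ˢ m) n
        ≈⟨ *-congʳ (recip!-suc m) ⟩
      recip! m * (∂ f ⊛ f ^ˢ m) n
        ≈⟨ *-distribˡ-sum {suc n} (recip! m) (λ i → ∂ f (toℕ i) * (f ^ˢ m) (n ∸ toℕ i)) ⟩
      ∑[ i ≤ n ] (recip! m * (∂ f (toℕ i) * (f ^ˢ m) (n ∸ toℕ i)))
        ≈⟨ (sum-cong-≋ {suc n} λ i →
             solve 3 (λ a b c → a :* (b :* c) := b :* (a :* c)) refl
               (recip! m) (∂ f (toℕ i)) ((f ^ˢ m) (n ∸ toℕ i))) ⟩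
      ∑[ i ≤ n ] (∂ f (toℕ i) * (recip! m * (f ^ˢ m) (n ∸ toℕ i))) ∎

  -- The equation f′ = x f fixes coefficient n + 1 from coefficient n, since n + 1 is invertible in
  -- characteristic zero.
  ∂-linear-unique : ∀ x {f g} → f 0 ≈ g 0 → ∂ f ≋ x • f → ∂ g ≋ x • g → f ≋ g
  ∂-linear-unique x {f} {g} f₀≈g₀ ∂f≋ ∂g≋ zero    = f₀≈g₀
  ∂-linear-unique x {f} {g} f₀≈g₀ ∂f≋ ∂g≋ (suc n) = #0-cancelˡ (char0 (suc n))
    (trans (∂f≋ n) (trans (*-congˡ (∂-linear-unique x {f} {g} f₀≈g₀ ∂f≋ ∂g≋ n)) (sym (∂g≋ n))))

  ∂t≋𝟙 : ∂ t ≋ 𝟙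
  ∂t≋𝟙 zero    = trans (*-identityʳ _) (+-identityʳ 1#)
  ∂t≋𝟙 (suc n) = zeroʳ _

  ∂-exp-• : ∀ x → ∂ (exp (x • t)) ≋ x • exp (x • t)
  ∂-exp-• x n = begin
    ∂ (exp (x • t)) n             ≈⟨ ∂-exp (x • t) (zeroʳ x) n ⟩
    (∂ (x • t) ⊛ exp (x • t)) n   ≈⟨ ⊛-congʳ (exp (x • t)) {∂ (x • t)} {x • 𝟙} (λ m → trans (∂-• x t m) (*-congˡ (∂t≋𝟙 m))) n ⟩
    ((x • 𝟙) ⊛ exp (x • t)) n     ≈⟨ •-⊛ x 𝟙 (exp (x • t)) n ⟩
    x * (𝟙 ⊛ exp (x • t)) n       ≈⟨ *-congˡ (⊛-identityˡ (exp (x • t)) n) ⟩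
    x * exp (x • t) n             ∎

  ∂-exp-t : ∂ (exp t) ≋ exp t
  ∂-exp-t n = begin
    ∂ (exp t) n         ≈⟨ ∂-exp t refl n ⟩
    (∂ t ⊛ exp t) n     ≈⟨ ⊛-congʳ (exp t) ∂t≋𝟙 n ⟩
    (𝟙 ⊛ exp t) n       ≈⟨ ⊛-identityˡ (exp t) n ⟩
    exp t n             ∎

  -- Both sides solve y′ = (m + 1) y with y(0) = 1, which avoids a binomial expansion.
  exp-suc : ∀ m → exp (fromℕ m • t) ⊛ exp t ≋ exp (fromℕ (suc m) • t)
  exp-suc m = ∂-linear-unique (fromℕ (suc m)) {E ⊛ exp t} {exp (fromℕ (suc m) • t)}
    (trans (⊛-constant (exp (fromℕ m • t)) (exp t) (exp-constant (fromℕ m • t)) (exp-constant t))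
           (sym (exp-constant (fromℕ (suc m) • t))))
    (λ n → begin
      ∂ (E ⊛ exp t) n                                ≈⟨ ∂-⊛ E (exp t) n ⟩
      (∂ E ⊛ exp t) n + (E ⊛ ∂ (exp t)) n            ≈⟨ +-cong
        (trans (⊛-congʳ (exp t) (∂-exp-• (fromℕ m)) n) (•-⊛ (fromℕ m) E (exp t) n))
        (⊛-congˡ E ∂-exp-t n) ⟩
      fromℕ m * (E ⊛ exp t) n + (E ⊛ exp t) n        ≈⟨ solve 2 (λ a b →
        a :* b :+ b := (con 1 :+ a) :* b) refl _ _ ⟩
      fromℕ (suc m) * (E ⊛ exp t) n                  ∎)
    (∂-exp-• (fromℕ (suc m)))
    where E = exp (fromℕ m • t)

  exp-zero : exp (0# • t) ≋ 𝟙
  exp-zero = ∂-linear-unique 0# {exp (0# • t)} {𝟙} (exp-constant (0# • t)) (∂-exp-• 0#)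
    (λ n → trans (∂𝟙≈0 n) (sym (zeroˡ _)))

  ∂^-cong : ∀ r → f ≋ g → ∂^ r f ≋ ∂^ r g
  ∂^-cong zero    f≋g = f≋g
  ∂^-cong (suc r) f≋g = ∂-cong (∂^-cong r f≋g)

  ∂^-⊕ : ∀ r f g → ∂^ r (f ⊕ g) ≋ ∂^ r f ⊕ ∂^ r g
  ∂^-⊕ zero    f g n = refl
  ∂^-⊕ (suc r) f g n = trans (∂-cong (∂^-⊕ r f g) n) (∂-⊕ (∂^ r f) (∂^ r g) n)

  ∂^-• : ∀ r x f → ∂^ r (x • f) ≋ x • ∂^ r f
  ∂^-• zero    x f n = refl
  ∂^-• (suc r) x f n = trans (∂-cong (∂^-• r x f) n) (∂-• x (∂^ r f) n)

  -- `∂^` applies its last derivative outermost, while the inductions below differentiate the given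
  -- series first.
  ∂^-suc : ∀ r f → ∂^ (suc r) f ≋ ∂^ r (∂ f)
  ∂^-suc zero    f n = refl
  ∂^-suc (suc r) f   = ∂-cong (∂^-suc r f)

  ∂^-constant : ∀ n f → ∂^ n f 0 ≈ fromℕ (n !) * f n
  ∂^-constant zero    f = solve 1 (λ a → a := (con 1 :+ con 0) :* a) refl _
  ∂^-constant (suc n) f = begin
    ∂^ (suc n) f 0                                  ≈⟨ ∂^-suc n f 0 ⟩
    ∂^ n (∂ f) 0                                    ≈⟨ ∂^-constant n (∂ f) ⟩
    fromℕ (n !) * (fromℕ (suc n) * f (suc n))       ≈⟨ solve 3 (λ a b c →
      a :* (b :* c) := b :* a :* c) refl _ _ _ ⟩
    fromℕ (suc n) * fromℕ (n !) * f (suc n)         ≈⟨ *-congʳ (fromℕ-* (suc n) (n !)) ⟨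
    fromℕ (suc n !) * f (suc n)                     ∎

-- Repeated derivatives of exp(x(eᵗ - 1))

module BellSeries {c ℓ₁ ℓ₂} (K : HeytingField c ℓ₁ ℓ₂) (char0 : CharacteristicZero K) where
  open FieldProperties K
  open PowerSeries K char0
  open PowerSeriesProperties K char0

  -- n! times the coefficient of tⁿ is the Touchard polynomial ∑ₖ S(n,k) xᵏ.
  touchard : Carrier → Series
  touchard x = exp (x • (exp t ⊖ 𝟙))

  ∂-touchard : ∀ x → ∂ (touchard x) ≋ x • (exp t ⊛ touchard x)
  ∂-touchard x n = begin
    ∂ (touchard x) n                              ≈⟨ ∂-exp f f₀≈0 n ⟩
    (∂ f ⊛ touchard x) n                          ≈⟨ ⊛-congʳ (touchard x) ∂f≋ n ⟩
    ((x • exp t) ⊛ touchard x) n                  ≈⟨ •-⊛ x (exp t) (touchard x) n ⟩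
    x * (exp t ⊛ touchard x) n                    ∎
    where
    f = x • (exp t ⊖ 𝟙)
    f₀≈0 : f 0 ≈ 0#
    f₀≈0 = trans (*-congˡ (trans (+-congʳ (exp-constant t)) (-‿inverseʳ 1#))) (zeroʳ x)
    ∂f≋ : ∂ f ≋ x • exp t
    ∂f≋ m = trans (∂-• x (exp t ⊖ 𝟙) m)
      (*-congˡ (trans (*-congˡ (x-0≈x (exp t (suc m)))) (∂-exp-t m)))

  -- ∂-shifted below mirrors #continuations-suc: the next element joins one of
  -- the m opened blocks or opens block m.
  shifted : Carrier → ℕ → Series
  shifted x m = (x ^ m) • (exp (fromℕ m • t) ⊛ touchard x)

  ∂-shifted : ∀ x m → ∂ (shifted x m) ≋ fromℕ m • shifted x m ⊕ shifted x (suc m)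
  ∂-shifted x m n = begin
    ∂ (shifted x m) n
      ≈⟨ ∂-• (x ^ m) (E ⊛ T) n ⟩
    x ^ m * ∂ (E ⊛ T) n
      ≈⟨ *-congˡ (∂-⊛ E T n) ⟩
    x ^ m * ((∂ E ⊛ T) n + (E ⊛ ∂ T) n)
      ≈⟨ *-congˡ (+-cong left right) ⟩
    x ^ m * (fromℕ m * (E ⊛ T) n + x * (E′ ⊛ T) n)
      ≈⟨ solve 5 (λ a b c d e → a :* (b :* c :+ d :* e) := b :* (a :* c) :+ d :* a :* e)
           refl _ _ _ _ _ ⟩
    fromℕ m * (x ^ m * (E ⊛ T) n) + x * x ^ m * (E′ ⊛ T) n ∎
    where
    T  = touchard x
    E  = exp (fromℕ m • t)
    E′ = exp (fromℕ (suc m) • t)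
    left : (∂ E ⊛ T) n ≈ fromℕ m * (E ⊛ T) n
    left = trans (⊛-congʳ T (∂-exp-• (fromℕ m)) n) (•-⊛ (fromℕ m) E T n)
    -- The derivative of T is x eᵗ T: the factor eᵗ raises `E` to `E′`, and x completes the power
    -- xᵐ⁺¹.
    right : (E ⊛ ∂ T) n ≈ x * (E′ ⊛ T) n
    right = begin
      (E ⊛ ∂ T) n                 ≈⟨ ⊛-congˡ E (∂-touchard x) n ⟩
      (E ⊛ (x • (exp t ⊛ T))) n   ≈⟨ ⊛-• x E (exp t ⊛ T) n ⟩
      x * (E ⊛ (exp t ⊛ T)) n     ≈⟨ *-congˡ (⊛-assoc E (exp t) T n) ⟨
      x * (E ⊛ exp t ⊛ T) n       ≈⟨ *-congˡ (⊛-congʳ T (exp-suc m) n) ⟩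
      x * (E′ ⊛ T) n              ∎

  -- At most m + n blocks can ever be opened, so any N > m + n captures all terms. Leaving N free
  -- lets the hypotheses for m and for m + 1 be added over one common range.
  ∂^-shifted : ∀ x n {m N} → m ℕ.+ n < N → ∀ j →
    ∂^ n (shifted x m) j ≈ ∑[ k < N ] (fromℕ (#continuations (toℕ k) n m) * shifted x (toℕ k) j)
  ∂^-shifted x zero {m} {N} m+0<N j = sym (begin
    ∑[ k < N ] (fromℕ (#continuations (toℕ k) 0 m) * shifted x (toℕ k) j)
      ≈⟨ sum-single (λ k → fromℕ (#continuations k 0 m) * shifted x k j)
           (λ k k≢m → trans (*-congʳ (reflexive (≡.cong fromℕ (#continuations-off-diag k≢m)))) (zeroˡ _))
           (≡.subst (_< N) (ℕ.+-identityʳ m) m+0<N) ⟩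
    fromℕ (#continuations m 0 m) * shifted x m j
      ≡⟨ ≡.cong (λ l → fromℕ l * shifted x m j) (#continuations-diag m) ⟩
    (1# + 0#) * shifted x m j
      ≈⟨ solve 1 (λ a → (con 1 :+ con 0) :* a := a) refl _ ⟩
    shifted x m j ∎)
  ∂^-shifted x (suc n) {m} {N} m+1+n<N j = begin
    ∂^ (suc n) (shifted x m) j
      ≈⟨ ∂^-suc n (shifted x m) j ⟩
    ∂^ n (∂ (shifted x m)) j
      ≈⟨ ∂^-cong n (∂-shifted x m) j ⟩
    ∂^ n (fromℕ m • shifted x m ⊕ shifted x (suc m)) j
      ≈⟨ ∂^-⊕ n (fromℕ m • shifted x m) (shifted x (suc m)) j ⟩
    ∂^ n (fromℕ m • shifted x m) j + ∂^ n (shifted x (suc m)) j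
      ≈⟨ +-congʳ (∂^-• n (fromℕ m) (shifted x m) j) ⟩
    fromℕ m * ∂^ n (shifted x m) j + ∂^ n (shifted x (suc m)) j
      ≈⟨ +-cong (*-congˡ (∂^-shifted x n (ℕ.<-trans (ℕ.+-monoʳ-< m (ℕ.n<1+n n)) m+1+n<N) j))
                (∂^-shifted x n (≡.subst (_< N) (ℕ.+-suc m n) m+1+n<N) j) ⟩
    fromℕ m * ∑[ k < N ] (⟦ toℕ k , m ⟧ * shifted x (toℕ k) j) +
    ∑[ k < N ] (⟦ toℕ k , suc m ⟧ * shifted x (toℕ k) j)
      ≈⟨ +-congʳ (*-distribˡ-sum {N} (fromℕ m) (λ k → ⟦ toℕ k , m ⟧ * shifted x (toℕ k) j)) ⟩
    ∑[ k < N ] (fromℕ m * (⟦ toℕ k , m ⟧ * shifted x (toℕ k) j)) +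
    ∑[ k < N ] (⟦ toℕ k , suc m ⟧ * shifted x (toℕ k) j)
      ≈⟨ ∑-distrib-+ {N} (λ k → fromℕ m * (⟦ toℕ k , m ⟧ * shifted x (toℕ k) j))
                         (λ k → ⟦ toℕ k , suc m ⟧ * shifted x (toℕ k) j) ⟨
    ∑[ k < N ] (fromℕ m * (⟦ toℕ k , m ⟧ * shifted x (toℕ k) j) +
                ⟦ toℕ k , suc m ⟧ * shifted x (toℕ k) j)
      ≈⟨ sum-cong-≋ {N} (λ k → summand (toℕ k)) ⟩
    ∑[ k < N ] (fromℕ (#continuations (toℕ k) (suc n) m) * shifted x (toℕ k) j) ∎
    where
    ⟦_,_⟧ : ℕ → ℕ → Carrier
    ⟦ k , m ⟧ = fromℕ (#continuations k n m)
    summand : ∀ k → fromℕ m * (⟦ k , m ⟧ * shifted x k j) + ⟦ k , suc m ⟧ * shifted x k j ≈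
                    fromℕ (#continuations k (suc n) m) * shifted x k j
    summand k = begin
      fromℕ m * (⟦ k , m ⟧ * s) + ⟦ k , suc m ⟧ * s
        ≈⟨ solve 4 (λ a b c d → a :* (b :* d) :+ c :* d := (a :* b :+ c) :* d) refl _ _ _ _ ⟩
      (fromℕ m * ⟦ k , m ⟧ + ⟦ k , suc m ⟧) * s
        ≈⟨ *-congʳ (+-congʳ (fromℕ-* m (#continuations k n m))) ⟨
      (fromℕ (m ℕ.* #continuations k n m) + ⟦ k , suc m ⟧) * s
        ≈⟨ *-congʳ (fromℕ-+ (m ℕ.* #continuations k n m) (#continuations k n (suc m))) ⟨
      fromℕ (m ℕ.* #continuations k n m ℕ.+ #continuations k n (suc m)) * s
        ≡⟨ ≡.cong (λ l → fromℕ l * s) (#continuations-suc k n m) ⟨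
      fromℕ (#continuations k (suc n) m) * s ∎
      where s = shifted x k j

  ∂^-touchard : ∀ x n j → ∂^ n (touchard x) j ≈
                ∑[ k ≤ n ] (fromℕ (#continuations (toℕ k) n 0) * shifted x (toℕ k) j)
  ∂^-touchard x n j = trans (∂^-cong n T≋shifted j) (∂^-shifted x n {0} {suc n} (ℕ.n<1+n n) j)
    where
    T≋shifted : touchard x ≋ shifted x 0
    T≋shifted i = sym (begin
      1# * (exp (0# • t) ⊛ touchard x) i   ≈⟨ *-identityˡ _ ⟩
      (exp (0# • t) ⊛ touchard x) i        ≈⟨ ⊛-congʳ (touchard x) exp-zero i ⟩
      (𝟙 ⊛ touchard x) i                   ≈⟨ ⊛-identityˡ (touchard x) i ⟩
      touchard x i                         ∎)

  touchard-coefficient : ∀ x n → fromℕ (n !) * touchard x n ≈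
                         ∑[ k ≤ n ] (fromℕ (#continuations (toℕ k) n 0) * x ^ toℕ k)
  touchard-coefficient x n = begin
    fromℕ (n !) * touchard x n
      ≈⟨ ∂^-constant n (touchard x) ⟨
    ∂^ n (touchard x) 0
      ≈⟨ ∂^-touchard x n 0 ⟩
    ∑[ k ≤ n ] (fromℕ (#continuations (toℕ k) n 0) * shifted x (toℕ k) 0)
      ≈⟨ sum-cong-≋ {suc n} (λ k → *-congˡ {fromℕ (#continuations (toℕ k) n 0)}
           (trans (*-congˡ (unit (toℕ k))) (*-identityʳ (x ^ toℕ k)))) ⟩
    ∑[ k ≤ n ] (fromℕ (#continuations (toℕ k) n 0) * x ^ toℕ k) ∎
    where
    unit : ∀ k → (exp (fromℕ k • t) ⊛ touchard x) 0 ≈ 1#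
    unit k = ⊛-constant (exp (fromℕ k • t)) (touchard x)
      (exp-constant (fromℕ k • t)) (exp-constant (x • (exp t ⊖ 𝟙)))

  -- A general g is needed for the induction, since `applyUpTo g` recurs with `g ∘ suc`; `upTo` is
  -- the case g = `id`.
  fromℕ-sum : ∀ (f g : ℕ → ℕ) N → fromℕ (sum (List.map f (applyUpTo g N))) ≈
              ∑[ k < N ] fromℕ (f (g (toℕ k)))
  fromℕ-sum f g zero    = refl
  fromℕ-sum f g (suc N) = trans
    (fromℕ-+ (f (g 0)) (sum (List.map f (applyUpTo (g ∘ suc) N))))
    (+-congˡ (fromℕ-sum f (g ∘ suc) N))

-- Binet's formula for the number of Fibonacci permutations

module Binet {c ℓ₁ ℓ₂} (K : HeytingField c ℓ₁ ℓ₂) (char0 : CharacteristicZero K)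
             (√5 : Field.Carrier K)
             (√5²≈5 : Field._≈_ K (Field._*_ K √5 √5) (Field.fromℕ K 5)) where
  open FieldProperties K
  open GoldenRatio K char0 √5 √5²≈5
  open import Algebra.Properties.Ring ring using (-‿distribˡ-*; -‿distribʳ-*; -‿involutive)

  ½ : Carrier
  ½ = recip (char0 2)

  ½+½≈1 : ½ + ½ ≈ 1#
  ½+½≈1 = trans (solve 1 (λ h → h :+ h := h :* (con 1 :+ (con 1 :+ con 0))) refl ½)
                (recip-inverseˡ (char0 2))

  -- Stated for an arbitrary square root s of 5, so that s = √5 yields α and s = -√5 yields β.
  golden : ∀ s → s * s ≈ fromℕ 5 → ((1# + s) * ½) * ((1# + s) * ½) ≈ (1# + s) * ½ + 1#
  golden s s²≈5 = begin
    ((1# + s) * ½) * ((1# + s) * ½)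
      ≈⟨ solve 2 (λ s h → ((con 1 :+ s) :* h) :* ((con 1 :+ s) :* h) :=
           (con 1 :+ (s :+ s) :+ s :* s) :* (h :* h)) refl s ½ ⟩
    (1# + (s + s) + s * s) * (½ * ½)
      ≈⟨ *-congʳ (+-congˡ s²≈5) ⟩
    (1# + (s + s) + fromℕ 5) * (½ * ½)
      -- The first factor is 6 + 2s = 2(3 + s), and its 2 cancels one of the two halves. What
      -- remains, (3 + s)/2, is (1 + s)/2 + 1.
      ≈⟨ solve 2 (λ s h → (con 1 :+ (s :+ s) :+
             (con 1 :+ (con 1 :+ (con 1 :+ (con 1 :+ (con 1 :+ con 0)))))) :* (h :* h) :=
           (con 1 :+ (con 1 :+ con 1) :+ s) :* (h :* (h :+ h))) refl s ½ ⟩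
    (1# + (1# + 1#) + s) * (½ * (½ + ½))
      ≈⟨ *-congˡ (*-congˡ ½+½≈1) ⟩
    (1# + (1# + 1#) + s) * (½ * 1#)
      ≈⟨ solve 2 (λ s h → (con 1 :+ (con 1 :+ con 1) :+ s) :* (h :* con 1) :=
           (con 1 :+ s) :* h :+ (h :+ h)) refl s ½ ⟩
    (1# + s) * ½ + (½ + ½)
      ≈⟨ +-congˡ ½+½≈1 ⟩
    (1# + s) * ½ + 1# ∎

  α²≈α+1 : α * α ≈ α + 1#
  α²≈α+1 = golden √5 √5²≈5

  β²≈β+1 : β * β ≈ β + 1#
  β²≈β+1 = golden (- √5) (begin
    - √5 * - √5       ≈⟨ -‿distribˡ-* √5 (- √5) ⟨
    - (√5 * - √5)     ≈⟨ -‿cong (-‿distribʳ-* √5 √5) ⟨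
    - - (√5 * √5)     ≈⟨ -‿involutive (√5 * √5) ⟩
    √5 * √5           ≈⟨ √5²≈5 ⟩
    fromℕ 5           ∎)

  -- Differences are written with e = −1 to become semiring expressions.
  e : Carrier
  e = - 1#

  e*e≈1 : e * e ≈ 1#
  e*e≈1 = begin
    e * e          ≈⟨ -‿distribˡ-* 1# e ⟨
    - (1# * e)     ≈⟨ -‿cong (*-identityˡ e) ⟩
    - e            ≈⟨ -‿involutive 1# ⟩
    1#             ∎

  -- The constants α/√5 and -β/√5 for which the Fibonacci number Fₖ₊₁ equals u αᵏ + v βᵏ.
  u v : Carrier
  u = 1/√5 * α
  v = 1/√5 * (e * β)

  α-β≈√5 : α + e * β ≈ √5
  α-β≈√5 = begin
    (1# + √5) * ½ + e * ((1# - √5) * ½)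
      ≈⟨ +-congˡ (*-congˡ (*-congʳ (x-y≈x+[-1]y 1# √5))) ⟩
    (1# + √5) * ½ + e * ((1# + e * √5) * ½)
      ≈⟨ solve 3 (λ s h e → (con 1 :+ s) :* h :+ e :* ((con 1 :+ e :* s) :* h) :=
           (con 1 :+ e) :* h :+ (s :* h :+ e :* e :* (s :* h))) refl √5 ½ e ⟩
    (1# + e) * ½ + (√5 * ½ + e * e * (√5 * ½))
      ≈⟨ +-cong (*-congʳ (-‿inverseʳ 1#)) (+-congˡ (*-congʳ e*e≈1)) ⟩
    0# * ½ + (√5 * ½ + 1# * (√5 * ½))
      ≈⟨ solve 2 (λ s h → con 0 :* h :+ (s :* h :+ con 1 :* (s :* h)) := s :* (h :+ h)) refl √5 ½ ⟩
    √5 * (½ + ½)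
      ≈⟨ *-congˡ ½+½≈1 ⟩
    √5 * 1#
      ≈⟨ *-identityʳ √5 ⟩
    √5 ∎

  u+v≈1 : u + v ≈ 1#
  u+v≈1 = begin
    1/√5 * α + 1/√5 * (e * β)    ≈⟨ distribˡ 1/√5 α (e * β) ⟨
    1/√5 * (α + e * β)           ≈⟨ *-congˡ α-β≈√5 ⟩
    1/√5 * √5                    ≈⟨ recip-inverseˡ √5#0 ⟩
    1#                           ∎

  -- Both sides satisfy the Fibonacci recurrence, the right one because α and β are roots of z² = z
  -- + 1. At k = 1 the same equation reduces the claim to u + v = 1, the two extra terms ±1/√5
  -- cancelling.
  binet : ∀ k → fromℕ (#fibonacciPermutations k) ≈ u * α ^ k + v * β ^ k
  binet 0 = sym (begin
    u * 1# + v * 1#    ≈⟨ +-cong (*-identityʳ u) (*-identityʳ v) ⟩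
    u + v              ≈⟨ u+v≈1 ⟩
    1#                 ≈⟨ +-identityʳ 1# ⟨
    1# + 0#            ∎)
  binet 1 = sym (begin
    u * (α * 1#) + v * (β * 1#)
      ≈⟨ solve 4 (λ r a e b → r :* a :* (a :* con 1) :+ r :* (e :* b) :* (b :* con 1) :=
           r :* (a :* a :+ e :* (b :* b))) refl 1/√5 α e β ⟩
    1/√5 * (α * α + e * (β * β))
      ≈⟨ *-congˡ (+-cong α²≈α+1 (*-congˡ β²≈β+1)) ⟩
    1/√5 * (α + 1# + e * (β + 1#))
      ≈⟨ solve 4 (λ r a e b → r :* (a :+ con 1 :+ e :* (b :+ con 1)) :=
           r :* a :+ r :* (e :* b) :+ r :* (con 1 :+ e)) refl 1/√5 α e β ⟩
    u + v + 1/√5 * (1# + e)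
      ≈⟨ +-cong u+v≈1 (trans (*-congˡ (-‿inverseʳ 1#)) (zeroʳ 1/√5)) ⟩
    1# + 0# ∎)
  binet (suc (suc k)) = begin
    fromℕ (#fibonacciPermutations (suc (suc k)))
      ≡⟨ ≡.cong fromℕ (#fibonacciPermutations-suc² k) ⟩
    fromℕ (#fibonacciPermutations (suc k) ℕ.+ #fibonacciPermutations k)
      ≈⟨ fromℕ-+ (#fibonacciPermutations (suc k)) (#fibonacciPermutations k) ⟩
    fromℕ (#fibonacciPermutations (suc k)) + fromℕ (#fibonacciPermutations k)
      ≈⟨ +-cong (binet (suc k)) (binet k) ⟩
    (u * (α * α ^ k) + v * (β * β ^ k)) + (u * α ^ k + v * β ^ k)
      ≈⟨ solve 6 (λ u v a b p q → (u :* (a :* p) :+ v :* (b :* q)) :+ (u :* p :+ v :* q) :=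
           u :* ((a :+ con 1) :* p) :+ v :* ((b :+ con 1) :* q)) refl u v α β (α ^ k) (β ^ k) ⟩
    u * ((α + 1#) * α ^ k) + v * ((β + 1#) * β ^ k)
      ≈⟨ +-cong (*-congˡ (*-congʳ α²≈α+1)) (*-congˡ (*-congʳ β²≈β+1)) ⟨
    u * (α * α * α ^ k) + v * (β * β * β ^ k)
      ≈⟨ +-cong (*-congˡ (*-assoc α α (α ^ k))) (*-congˡ (*-assoc β β (β ^ k))) ⟩
    u * (α * (α * α ^ k)) + v * (β * (β * β ^ k)) ∎

-- The generating function and its derivatives

module FubiniSeries {c ℓ₁ ℓ₂} (K : HeytingField c ℓ₁ ℓ₂) (char0 : CharacteristicZero K)
             (√5 : Field.Carrier K)
             (√5²≈5 : Field._≈_ K (Field._*_ K √5 √5) (Field.fromℕ K 5)) where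
  open FieldProperties K
  open PowerSeries K char0
  open GoldenRatio K char0 √5 √5²≈5
  open PowerSeriesProperties K char0
  open BellSeries K char0
  open Binet K char0 √5 √5²≈5

  -- The expansions for α and β share the coefficients s k. Here they are merged, once with powers
  -- of α and β and once with the series `shifted`.
  combine-sums : ∀ {N} (s p q : Fin N → Carrier) →
    u * ∑[ k < N ] (s k * p k) + v * ∑[ k < N ] (s k * q k) ≈
    ∑[ k < N ] (s k * (u * p k + v * q k))
  combine-sums {N} s p q = begin
    u * ∑[ k < N ] (s k * p k) + v * ∑[ k < N ] (s k * q k)
      ≈⟨ +-cong (*-distribˡ-sum {N} u (λ k → s k * p k)) (*-distribˡ-sum {N} v (λ k → s k * q k)) ⟩
    ∑[ k < N ] (u * (s k * p k)) + ∑[ k < N ] (v * (s k * q k))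
      ≈⟨ ∑-distrib-+ {N} (λ k → u * (s k * p k)) (λ k → v * (s k * q k)) ⟨
    ∑[ k < N ] (u * (s k * p k) + v * (s k * q k))
      ≈⟨ sum-cong-≋ {N} (λ k → solve 5 (λ u v s p q →
           u :* (s :* p) :+ v :* (s :* q) := s :* (u :* p :+ v :* q)) refl u v (s k) (p k) (q k)) ⟩
    ∑[ k < N ] (s k * (u * p k + v * q k)) ∎

  egf-𝓕 : egf 𝓕 ≋ u • touchard α ⊕ v • touchard β
  egf-𝓕 n = #0-cancelˡ (char0 (n !) {{n ℕ.!≢0}}) (begin
    fromℕ (n !) * (fromℕ (𝓕 n) * recip! n)
      ≈⟨ solve 3 (λ a b c → a :* (b :* c) := b :* (c :* a)) refl _ _ _ ⟩
    fromℕ (𝓕 n) * (recip! n * fromℕ (n !))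
      ≈⟨ *-congˡ (recip!-inverseˡ n) ⟩
    fromℕ (𝓕 n) * 1#
      ≈⟨ *-identityʳ _ ⟩
    fromℕ (𝓕 n)
      ≡⟨ ≡.cong fromℕ (𝓕≡sum n) ⟩
    fromℕ (sum (List.map (λ k → #continuations k n 0 ℕ.* #fibonacciPermutations k) (upTo (suc n))))
      ≈⟨ fromℕ-sum (λ k → #continuations k n 0 ℕ.* #fibonacciPermutations k) id (suc n) ⟩
    ∑[ k ≤ n ] fromℕ (#continuations (toℕ k) n 0 ℕ.* #fibonacciPermutations (toℕ k))
      ≈⟨ sum-cong-≋ {suc n} (λ k → trans
           (fromℕ-* (#continuations (toℕ k) n 0) (#fibonacciPermutations (toℕ k)))
           (*-congˡ (binet (toℕ k)))) ⟩
    ∑[ k ≤ n ] (fromℕ (#continuations (toℕ k) n 0) * (u * α ^ toℕ k + v * β ^ toℕ k))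
      ≈⟨ combine-sums {suc n} (λ k → fromℕ (#continuations (toℕ k) n 0))
           (λ k → α ^ toℕ k) (λ k → β ^ toℕ k) ⟨
    u * ∑[ k ≤ n ] (fromℕ (#continuations (toℕ k) n 0) * α ^ toℕ k) +
    v * ∑[ k ≤ n ] (fromℕ (#continuations (toℕ k) n 0) * β ^ toℕ k)
      ≈⟨ +-cong (*-congˡ (touchard-coefficient α n)) (*-congˡ (touchard-coefficient β n)) ⟨
    u * (fromℕ (n !) * touchard α n) + v * (fromℕ (n !) * touchard β n)
      ≈⟨ solve 5 (λ u v a b c → u :* (a :* b) :+ v :* (a :* c) := a :* (u :* b :+ v :* c))
           refl u v _ _ _ ⟩
    fromℕ (n !) * (u * touchard α n + v * touchard β n) ∎)

  ∂^-egf-𝓕 : ∀ r n → ∂^ r (egf 𝓕) n ≈ ∑[ k ≤ r ]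
    (fromℕ (#continuations (toℕ k) r 0) * (u * shifted α (toℕ k) n + v * shifted β (toℕ k) n))
  ∂^-egf-𝓕 r n = begin
    ∂^ r (egf 𝓕) n
      ≈⟨ ∂^-cong r egf-𝓕 n ⟩
    ∂^ r (u • touchard α ⊕ v • touchard β) n
      ≈⟨ ∂^-⊕ r (u • touchard α) (v • touchard β) n ⟩
    ∂^ r (u • touchard α) n + ∂^ r (v • touchard β) n
      ≈⟨ +-cong (∂^-• r u (touchard α) n) (∂^-• r v (touchard β) n) ⟩
    u * ∂^ r (touchard α) n + v * ∂^ r (touchard β) n
      ≈⟨ +-cong (*-congˡ (∂^-touchard α r n)) (*-congˡ (∂^-touchard β r n)) ⟩
    u * ∑[ k ≤ r ] (fromℕ (#continuations (toℕ k) r 0) * shifted α (toℕ k) n) +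
    v * ∑[ k ≤ r ] (fromℕ (#continuations (toℕ k) r 0) * shifted β (toℕ k) n)
      ≈⟨ combine-sums {suc r} (λ k → fromℕ (#continuations (toℕ k) r 0))
           (λ k → shifted α (toℕ k) n) (λ k → shifted β (toℕ k) n) ⟩
    ∑[ k ≤ r ] (fromℕ (#continuations (toℕ k) r 0) *
                (u * shifted α (toℕ k) n + v * shifted β (toℕ k) n)) ∎

  summand : ℕ → ℕ → Series
  summand r i = exp (fromℕ i • t) ⊛
    (fromℕ (stirling₂ r i) • (α ^ suc i • touchard α ⊖ β ^ suc i • touchard β))

  -- The scalars leave the convolution, and 1/√5 absorbs one factor of each power: αⁱ⁺¹/√5 = u αⁱ
  -- and -βⁱ⁺¹/√5 = v βⁱ.
  summand≈ : ∀ r i n → 1/√5 * summand r i n ≈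
    fromℕ (#continuations i r 0) * (u * shifted α i n + v * shifted β i n)
  summand≈ r i n = begin
    1/√5 * (E ⊛ (S • (A ⊖ B))) n
      ≈⟨ *-congˡ (⊛-• S E (A ⊖ B) n) ⟩
    1/√5 * (S * (E ⊛ (A ⊖ B)) n)
      ≈⟨ *-congˡ (*-congˡ (⊛-congˡ E {A ⊖ B} {A ⊕ e • B} (λ m → x-y≈x+[-1]y (A m) (B m)) n)) ⟩
    1/√5 * (S * (E ⊛ (A ⊕ e • B)) n)
      ≈⟨ *-congˡ (*-congˡ (trans (⊛-distribˡ E A (e • B) n) (+-congˡ (⊛-• e E B n)))) ⟩
    1/√5 * (S * ((E ⊛ A) n + e * (E ⊛ B) n))
      ≈⟨ *-congˡ (*-congˡ (+-cong (⊛-• (α ^ suc i) E (touchard α) n)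
                                  (*-congˡ (⊛-• (β ^ suc i) E (touchard β) n)))) ⟩
    1/√5 * (S * (α ^ suc i * (E ⊛ touchard α) n + e * (β ^ suc i * (E ⊛ touchard β) n)))
      ≈⟨ solve 9 (λ r s a p x e b q y →
           r :* (s :* (a :* p :* x :+ e :* (b :* q :* y))) :=
           s :* (r :* a :* (p :* x) :+ r :* (e :* b) :* (q :* y))) refl
           1/√5 S α (α ^ i) ((E ⊛ touchard α) n) e β (β ^ i) ((E ⊛ touchard β) n) ⟩
    S * (u * shifted α i n + v * shifted β i n)
      ≡⟨ ≡.cong (λ l → fromℕ l * (u * shifted α i n + v * shifted β i n))
           (stirling₂≡#continuations r i) ⟩
    fromℕ (#continuations i r 0) * (u * shifted α i n + v * shifted β i n) ∎
    where
    E = exp (fromℕ i • t)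
    S = fromℕ (stirling₂ r i)
    A = α ^ suc i • touchard α
    B = β ^ suc i • touchard β

  ∂^-egf-𝓕-stirling₂ : ∀ r → 1 ≤ r → ∂^ r (egf 𝓕) ≋ 1/√5 • ∑₁ r (summand r)
  ∂^-egf-𝓕-stirling₂ (suc r) _ n = begin
    ∂^ (suc r) (egf 𝓕) n
      ≈⟨ ∂^-egf-𝓕 (suc r) n ⟩
    fromℕ (#continuations 0 (suc r) 0) * (u * shifted α 0 n + v * shifted β 0 n) + rest
      -- The term k = 0 drops out because a nonempty set has no partition into zero blocks. This is
      -- where r ≥ 1 enters, and why the sum in the theorem starts at i = 1.
      ≈⟨ +-congʳ (trans (*-congʳ (reflexive (≡.cong fromℕ none))) (zeroˡ _)) ⟩
    0# + rest
      ≈⟨ +-identityˡ rest ⟩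
    rest
      ≈⟨ sum-cong-≋ {suc r} (λ i → summand≈ (suc r) (suc (toℕ i)) n) ⟨
    ∑[ i ≤ r ] (1/√5 * summand (suc r) (suc (toℕ i)) n)
      ≈⟨ *-distribˡ-sum {suc r} 1/√5 (λ i → summand (suc r) (suc (toℕ i)) n) ⟨
    1/√5 * ∑₁ (suc r) (summand (suc r)) n ∎
    where
    rest = ∑[ i ≤ r ] (fromℕ (#continuations (suc (toℕ i)) (suc r) 0) *
                       (u * shifted α (suc (toℕ i)) n + v * shifted β (suc (toℕ i)) n))
    none : #continuations 0 (suc r) 0 ≡ 0
    none = ≡.trans (#continuations-suc 0 r 0) (#continuations-> r (s≤s z≤n))

theorem7 :
    ∀ {c ℓ₁ ℓ₂} (K : HeytingField c ℓ₁ ℓ₂) (char0 : CharacteristicZero K) →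
    let open Field K in
    (√5 : Carrier) (√5²≈5 : √5 * √5 ≈ fromℕ 5) →
    let open PowerSeries K char0
        open GoldenRatio K char0 √5 √5²≈5
    in
    (r : ℕ) → 1 ≤ r →
    ∂^ r (egf 𝓕) ≋
      1/√5 • ∑₁ r (λ i →
        exp (fromℕ i • t) ⊛
        (fromℕ (stirling₂ r i) •
          (α ^ suc i • exp (α • (exp t ⊖ 𝟙)) ⊖ β ^ suc i • exp (β • (exp t ⊖ 𝟙)))))
theorem7 K char0 √5 √5²≈5 = FubiniSeries.∂^-egf-𝓕-stirling₂ K char0 √5 √5²≈5
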